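{- Let $b$ be even and $a\ge b\ge 2$. If the spider $S(a,b,1)$ is $e$-positive, then: (1) if $b\equiv 2\pmod 3$, then either $a\equiv 0\pmod 3$ and $a\le 2b+2$, or $a\equiv1\pmod 3$ and $a\le 2b-3$ (in particular $a\not\equiv 2\pmod 3$); (2) if $b\not\equiv 2\pmod 3$, then $a\le b^2-1$ or $a=b^2+b$; (3) if $a$ is even, then $a>b+\frac{1+\sqrt{8b-3}}{2}$. -}

module Defs where

open import Data.Bool.Base using (if_then_else_)
open import Data.Fin.Base using (Fin; toℕ; finToFun)
import Data.Fin.Properties as Fin
open import Data.Integer.Base as ℤ using (ℤ; +_; 0ℤ; 1ℤ)
open import Data.List.Base
  using (List; []; _∷_; _++_; map; foldr; filter; length; tabulate; allFin; upTo; applyUpTo; cartesianProductWith)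
open import Data.List.Membership.Propositional using (_∈_)
open import Data.List.Properties using (≡-dec)
open import Data.List.Relation.Unary.All as All using (All; []; _∷_)
open import Data.List.Relation.Unary.All.Properties using (++⁺; map⁺)
open import Data.List.Relation.Unary.Linked using (Linked)
open import Data.List.Relation.Unary.Unique.Propositional using (Unique)
open import Data.Nat.Base using (ℕ; zero; suc; _+_; _∸_; _^_; _<_; _≥_; s≤s; z≤n)
open import Data.Nat.ListAction using (sum)
open import Data.Nat.Properties using (_≟_; _≤?_; <-irrefl; +-monoʳ-<; n<1+n)
open import Data.Product.Base using (_×_; _,_; Σ-syntax)
import Data.Product.Properties as Product
open import Data.Sum.Base using (_⊎_; inj₁; inj₂; swap)
open import Level using (0ℓ)
open import Relation.Binary.Core using (Rel)
open import Relation.Binary.Definitions using (Decidable; Symmetric)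
open import Relation.Binary.PropositionalEquality using (_≡_; _≢_; refl)
import Relation.Unary as U
open import Relation.Nullary using (¬_)
open import Relation.Nullary.Decidable using (does; ¬?; _×-dec_; _⊎-dec_; _→-dec_)

------------------------------------------------------------------------
-- Finite simple graphs

record Graph : Set₁ where
  field
    order  : ℕ
    Adj    : Rel (Fin order) 0ℓ
    adj?   : Decidable Adj
    sym    : Symmetric Adj
    irrefl : ∀ {v} → ¬ Adj v v

------------------------------------------------------------------------
-- Spiders

-- A leg of length l occupies the vertices s, s+1, …, s+l-1, the first of
-- which is joined to the centre, vertex 0.
legEdges : ℕ → ℕ → List (ℕ × ℕ)
legEdges s zero    = []
legEdges s (suc l) = (0 , s) ∷ map (λ i → s + i , s + suc i) (upTo l)

legsEdges : ℕ → List ℕ → List (ℕ × ℕ)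
legsEdges s []       = []
legsEdges s (l ∷ ls) = legEdges s l ++ legsEdges (s + l) ls

private
  Ascending : ℕ × ℕ → Set
  Ascending (u , v) = u < v

  legEdges-ascending : ∀ s l → 0 < s → All Ascending (legEdges s l)
  legEdges-ascending s zero    0<s = []
  legEdges-ascending s (suc l) 0<s =
    0<s ∷ map⁺ (All.universal (λ i → +-monoʳ-< s (n<1+n i)) (upTo l))

  legsEdges-ascending : ∀ s ls → 0 < s → All Ascending (legsEdges s ls)
  legsEdges-ascending s       []       0<s = []
  legsEdges-ascending (suc s) (l ∷ ls) 0<s =
    ++⁺ (legEdges-ascending (suc s) l 0<s) (legsEdges-ascending (suc s + l) ls (s≤s z≤n))

-- spider (l₁ ∷ … ∷ lₖ ∷ []) is the tree S(l₁,…,lₖ): paths with l₁, …, lₖ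
-- vertices, each attached by an end to a common centre.
spider : List ℕ → Graph
spider ls = record
  { order  = suc (sum ls)
  ; Adj    = λ u v → Edge (toℕ u) (toℕ v) ⊎ Edge (toℕ v) (toℕ u)
  ; adj?   = λ u v → edge? (toℕ u) (toℕ v) ⊎-dec edge? (toℕ v) (toℕ u)
  ; sym    = swap
  ; irrefl = λ { (inj₁ e) → loopless e ; (inj₂ e) → loopless e }
  }
  where
  open import Data.List.Membership.DecPropositional (Product.≡-dec _≟_ _≟_) using (_∈?_)

  Edge : ℕ → ℕ → Set
  Edge i j = (i , j) ∈ legsEdges 1 ls

  edge? : Decidable Edge
  edge? i j = (i , j) ∈? legsEdges 1 ls

  loopless : ∀ {i} → ¬ Edge i i
  loopless e = <-irrefl refl (All.lookup (legsEdges-ascending 1 ls (s≤s z≤n)) e)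

------------------------------------------------------------------------
-- Formal power series over ℤ in x₀, x₁, x₂, …

-- The list α₀ ∷ … ∷ αₖ₋₁ ∷ [] stands for the monomial x₀^α₀ ⋯ xₖ₋₁^αₖ₋₁;
-- a series is given by its coefficients.  The series below do not
-- distinguish lists that differ by trailing zeros.
Monomial : Set
Monomial = List ℕ

Series : Set
Series = Monomial → ℤ

sumℤ : List ℤ → ℤ
sumℤ = foldr ℤ._+_ 0ℤ

-- All (β , γ) with x^β · x^γ = x^α.
factorisations : Monomial → List (Monomial × Monomial)
factorisations []      = ([] , []) ∷ []
factorisations (n ∷ α) =
  cartesianProductWith (λ (i , j) (β , γ) → i ∷ β , j ∷ γ)
    (applyUpTo (λ i → i , n ∸ i) (suc n)) (factorisations α)

infixl 7 _⊛_
_⊛_ : Series → Series → Series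
(f ⊛ g) α = sumℤ (map (λ (β , γ) → f β ℤ.* g γ) (factorisations α))

-- The elementary symmetric function e_k: the sum of all squarefree
-- monomials of degree k.  In particular elementary 0 is the unit series.
elementary : ℕ → Series
elementary k α = if does (All.all? (_≤? 1) α ×-dec (sum α ≟ k)) then 1ℤ else 0ℤ

-- e_λ = e_λ₁ e_λ₂ ⋯
elementaryOf : List ℕ → Series
elementaryOf = foldr (λ k f → elementary k ⊛ f) (elementary 0)

------------------------------------------------------------------------
-- The chromatic symmetric function

module _ (G : Graph) where
  open Graph G

  Colouring : ℕ → Set
  Colouring k = Fin order → Fin k

  Proper : ∀ {k} → Colouring k → Set
  Proper κ = ∀ u v → Adj u v → κ u ≢ κ v

  proper? : ∀ {k} → U.Decidable (Proper {k})
  proper? κ = Fin.all? λ u → Fin.all? λ v → adj? u v →-dec ¬? (κ u Fin.≟ κ v)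

  -- The exponents of x^κ = ∏_v x_κ(v).
  weight : ∀ {k} → Colouring k → Monomial
  weight κ = tabulate λ i → length (filter (λ v → κ v Fin.≟ i) (allFin order))

  colourings : ∀ k → List (Colouring k)
  colourings k = map finToFun (allFin (k ^ order))

  -- X_G = Σ x^κ over the proper colourings κ with colours 0, 1, 2, ….
  -- A colouring contributing to x₀^α₀ ⋯ xₖ₋₁^αₖ₋₁ only uses colours below k.
  chromatic : Series
  chromatic α =
    + length (filter (λ κ → proper? κ ×-dec ≡-dec _≟_ (weight κ) α) (colourings (length α)))

------------------------------------------------------------------------
-- e-positivity

IsPartition : List ℕ → Set
IsPartition μ = Linked _≥_ μ × All (0 <_) μ

-- f = Σ_μ coeff(μ) e_μ, a finite sum over distinct partitions μ.
record EExpansion (f : Series) : Set where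
  field
    support    : List (List ℕ)
    partitions : All IsPartition support
    distinct   : Unique support
    coeff      : List ℕ → ℤ
    expansion  : ∀ α → f α ≡ sumℤ (map (λ μ → coeff μ ℤ.* elementaryOf μ α) support)

EPositive : Series → Set
EPositive f = Σ[ E ∈ EExpansion f ] All (λ μ → 0ℤ ℤ.≤ EExpansion.coeff E μ) (EExpansion.support E)

-- A graph is e-positive if its chromatic symmetric function is.
EPositiveGraph : Graph → Set
EPositiveGraph G = EPositive (chromatic G)

------------------------------------------------------------------------
-- Comparison with a square root

-- x > √d as real numbers, where √d is the nonnegative root.
infix 4 _>√_
_>√_ : ℤ → ℕ → Set
x >√ d = (0ℤ ℤ.≤ x) × (+ d ℤ.< x ℤ.* x)

{-# OPTIONS --safe #-}

-- Let p_n be the chromatic symmetric function of the path with n vertices.  Then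
-- X_{S(a,b,1)} + p_{a+1} p_{b+1} = p_{a+b+2} + e₁ p_{a+b+1}, and Σ p_n zⁿ = E/(E - z E′) for
-- E = Σ eᵢ zⁱ.  The eᵢ being algebraically independent, values in any commutative semiring may be
-- substituted for them.  If the spider is e-positive, then values in ℕ[[ε]] with e₁ = 0 give
-- p_{a+1} p_{b+1} ≤ p_{a+b+2} coefficientwise.  Put e_d = 1 and e_r = ε, and let the other eᵢ
-- vanish.  If d divides b + 1 and a + 1 ≡ r (mod d), the coefficients of ε⁰ and ε¹ bound a:
-- clause (1) is the case d = 3, and clause (2) is the case d = b + 1.  Clause (3) comes from the
-- coefficient of ε² for d = 2 and r = 3.
module Submission where

open import Defs
open import Algebra.Bundles using (CommutativeMonoid; CommutativeSemiring)
import Algebra.Construct.Pointwise as Pointwise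
open import Algebra.Definitions using (RightCancellative)
import Algebra.Properties.CommutativeSemigroup as CommutativeSemigroup
import Algebra.Properties.Ring as Ring
open import Data.Bool.Base using (true; false; if_then_else_)
open import Data.Bool.Properties using (∧-zeroʳ)
open import Data.Fin.Base using (Fin; zero; suc; toℕ; fromℕ<; finToFun; quotient; remainder; _↑ˡ_; _↑ʳ_)
import Data.Fin.Properties as Fin
open import Data.Integer.Base as ℤ using (ℤ; +_; 0ℤ; 1ℤ; ∣_∣; _⊖_)
import Data.Integer.Properties as ℤ
open import Data.List.Base
  using (List; []; _∷_; _++_; map; foldr; filter; length; tabulate; allFin; upTo; applyUpTo;
         replicate; concatMap; cartesianProductWith)
open import Data.List.Membership.Propositional using (_∈_)
import Data.List.Properties as List
open import Data.List.Relation.Binary.Permutation.Propositional as Perm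
  using (_↭_; ↭-refl; ↭-trans)
open import Data.List.Relation.Unary.All as All using (All; []; _∷_)
import Data.List.Relation.Unary.All.Properties as All
open import Data.Nat.Base as ℕ
  using (ℕ; zero; suc; pred; _∸_; _^_; _≤_; _<_; _≥_; _≡ᵇ_; s≤s; z≤n; NonZero; >-nonZero)
open import Data.Nat.Divisibility using (_∣_; divides)
open import Data.Nat.DivMod using (_%_; _/_; m≡m%n+[m/n]*n; m%n<n)
open import Data.Nat.ListAction using (sum)
import Data.Nat.Properties as ℕ
open import Data.Nat.Tactic.RingSolver using (solve-∀)
open import Data.Product.Base using (Σ-syntax; ∃-syntax; _×_; _,_; proj₁; proj₂)
open import Data.Sum.Base using (_⊎_; inj₁; inj₂)
open import Data.Unit.Base using (⊤; tt)
open import Function.Base using (id; _∘_)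
open import Level using (0ℓ)
open import Relation.Binary.Definitions using (tri<; tri≈; tri>)
open import Relation.Binary.PropositionalEquality as ≡ using (_≡_; _≢_)
import Relation.Binary.Reasoning.Setoid as SetoidReasoning
open import Relation.Nullary using (¬_; Dec; yes; no; contradiction)
open import Relation.Nullary.Decidable using (does; _×-dec_)

-- Power series

-- A `Series` is a bare function on exponent lists. Each identity is therefore proved for its part
-- in k variables, for every k, inside an iterated power series ring. Passing from there to
-- arbitrary values of the eᵢ is what needs algebraic independence. No identity contains a
-- subtraction: terms are moved across until all signs are positive, and cancellation replaces
-- negation. Both sides are then sums of monomials with multiplicities in ℕ, which can be evaluated
-- in a semiring without negatives, where the value of the spider's own expansion is the slack of an
-- inequality. Why this bounds a: with e_d = 1 and the other values zero, p_n vanishes unless d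
-- divides n. If d divides b + 1, then p_{b+1} contributes at ε⁰, while p_{a+1} needs one factor e_r
-- to fill its residue. Up to powers of d - 1, the ε-coefficient of p_{a+1} is a linear function X
-- of the quotient of a + 1 by d. The product compares d X with d - 1 times the sum of X and a
-- constant depending on b, so X is bounded. Clause (3) has both indices odd with d = 2, so each
-- factor costs one ε.

module PowerSeries (R : CommutativeSemiring 0ℓ 0ℓ) where
  open CommutativeSemiring R hiding (zero)
  open import Algebra.Solver.Ring.NaturalCoefficients.Default R
    using (solve; _:+_; _:*_; _:=_)
  open SetoidReasoning setoid

  PS : Set
  PS = ℕ → Carrier

  infix 4 _≋_
  _≋_ : PS → PS → Set
  f ≋ g = ∀ n → f n ≈ g n

  tail : PS → PS
  tail f n = f (suc n)

  infixl 6 _⊕_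
  _⊕_ : PS → PS → PS
  (f ⊕ g) n = f n + g n

  -- With f = f₀ + z f′ this is f g = f₀ g + z (f′ g).
  infixl 7 _⊗_
  _⊗_ : PS → PS → PS
  (f ⊗ g) zero    = f 0 * g 0
  (f ⊗ g) (suc n) = f 0 * g (suc n) + (tail f ⊗ g) n

  constant : Carrier → PS
  constant a zero    = a
  constant a (suc n) = 0#

  z : PS
  z zero    = 0#
  z (suc n) = constant 1# n

  ⊗-cong : ∀ {f f′ g g′} → f ≋ f′ → g ≋ g′ → f ⊗ g ≋ f′ ⊗ g′
  ⊗-cong p q zero    = *-cong (p 0) (q 0)
  ⊗-cong p q (suc n) = +-cong (*-cong (p 0) (q (suc n))) (⊗-cong (λ m → p (suc m)) q n)

  ⊗-distribʳ : ∀ h f g → (f ⊕ g) ⊗ h ≋ f ⊗ h ⊕ g ⊗ h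
  ⊗-distribʳ h f g zero    = distribʳ _ _ _
  ⊗-distribʳ h f g (suc n) = trans (+-congˡ (⊗-distribʳ h (tail f) (tail g) n))
    (solve 5 (λ a b c d e → (a :+ b) :* c :+ (d :+ e) := a :* c :+ d :+ (b :* c :+ e)) refl _ _ _ _ _)

  ⊗-scale : ∀ a f g → (λ n → a * f n) ⊗ g ≋ λ n → a * (f ⊗ g) n
  ⊗-scale a f g zero    = *-assoc _ _ _
  ⊗-scale a f g (suc n) = trans (+-congˡ (⊗-scale a (tail f) g n))
    (solve 4 (λ a b c d → a :* b :* c :+ a :* d := a :* (b :* c :+ d)) refl _ _ _ _)

  -- The definition peels off the first factor; peeling off the second one as well makes
  -- commutativity a plain induction.
  ⊗-sucʳ : ∀ f g n → (f ⊗ g) (suc n) ≈ f (suc n) * g 0 + (f ⊗ tail g) n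
  ⊗-sucʳ f g zero    = +-comm _ _
  ⊗-sucʳ f g (suc n) = trans (+-congˡ (⊗-sucʳ (tail f) g n))
    (solve 3 (λ a b c → a :+ (b :+ c) := b :+ (a :+ c)) refl _ _ _)

  ⊗-comm : ∀ f g → f ⊗ g ≋ g ⊗ f
  ⊗-comm f g zero    = *-comm _ _
  ⊗-comm f g (suc n) = trans (+-cong (*-comm _ _) (⊗-comm (tail f) g n)) (sym (⊗-sucʳ g f n))

  ⊗-assoc : ∀ f g h → (f ⊗ g) ⊗ h ≋ f ⊗ (g ⊗ h)
  ⊗-assoc f g h zero    = *-assoc _ _ _
  ⊗-assoc f g h (suc n) = begin
    f 0 * g 0 * h (suc n) + (((λ m → f 0 * tail g m) ⊕ tail f ⊗ g) ⊗ h) n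
      ≈⟨ +-congˡ (⊗-distribʳ h _ _ n) ⟩
    f 0 * g 0 * h (suc n) + (((λ m → f 0 * tail g m) ⊗ h) n + ((tail f ⊗ g) ⊗ h) n)
      ≈⟨ +-congˡ (+-cong (⊗-scale (f 0) (tail g) h n) (⊗-assoc (tail f) g h n)) ⟩
    f 0 * g 0 * h (suc n) + (f 0 * (tail g ⊗ h) n + (tail f ⊗ (g ⊗ h)) n)
      ≈⟨ solve 5 (λ a b c d e → a :* b :* c :+ (a :* d :+ e) := a :* (b :* c :+ d) :+ e) refl _ _ _ _ _ ⟩
    f 0 * (g 0 * h (suc n) + (tail g ⊗ h) n) + (tail f ⊗ (g ⊗ h)) n ∎

  ⊗-zeroˡ : ∀ f → (λ _ → 0#) ⊗ f ≋ λ _ → 0#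
  ⊗-zeroˡ f zero    = zeroˡ _
  ⊗-zeroˡ f (suc n) = trans (+-cong (zeroˡ _) (⊗-zeroˡ f n)) (+-identityˡ _)

  constant-⊗ : ∀ a f n → (constant a ⊗ f) n ≈ a * f n
  constant-⊗ a f zero    = refl
  constant-⊗ a f (suc n) = trans (+-congˡ (⊗-zeroˡ f n)) (+-identityʳ _)

  ⊗-identityˡ : ∀ f → constant 1# ⊗ f ≋ f
  ⊗-identityˡ f n = trans (constant-⊗ 1# f n) (*-identityˡ _)

  powerSeries : CommutativeSemiring 0ℓ 0ℓ
  powerSeries = record
    { Carrier = PS
    ; _≈_ = _≋_
    ; _+_ = _⊕_
    ; _*_ = _⊗_
    ; 0# = λ _ → 0#
    ; 1# = constant 1#
    ; isCommutativeSemiring = record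
      { isSemiring = record
        { isSemiringWithoutAnnihilatingZero = record
          { +-isCommutativeMonoid = Pointwise.isCommutativeMonoid ℕ +-isCommutativeMonoid
          ; *-cong = ⊗-cong
          ; *-assoc = ⊗-assoc
          ; *-identity = ⊗-identityˡ , λ f n → trans (⊗-comm f _ n) (⊗-identityˡ f n)
          ; distrib = (λ h f g n → trans (⊗-comm h _ n)
              (trans (⊗-distribʳ h f g n) (+-cong (⊗-comm f h n) (⊗-comm g h n)))) , ⊗-distribʳ
          }
        ; zero = ⊗-zeroˡ , λ f n → trans (⊗-comm f _ n) (⊗-zeroˡ f n)
        }
      ; *-comm = ⊗-comm
      }
    }

  z-⊗-zero : ∀ f → (z ⊗ f) 0 ≈ 0#
  z-⊗-zero f = zeroˡ _

  z-⊗-suc : ∀ f n → (z ⊗ f) (suc n) ≈ f n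
  z-⊗-suc f n = trans (+-cong (zeroˡ _) (⊗-identityˡ f n)) (+-identityˡ _)

-- Proper colourings of spiders as words

module Words (S : CommutativeSemiring 0ℓ 0ℓ) {k : ℕ} (x : Fin k → CommutativeSemiring.Carrier S) where
  open CommutativeSemiring S hiding (zero)
  open import Algebra.Properties.Semiring.Sum semiring
    renaming (sum to ∑) using (sum-cong-≋; *-distribˡ-sum)
  open import Algebra.Solver.Ring.NaturalCoefficients.Default S
    using (solve; _:*_; _:=_)
  open SetoidReasoning setoid

  sumW : ℕ → (List (Fin k) → Carrier) → Carrier
  sumW zero    f = f []
  sumW (suc m) f = ∑ λ c → sumW m λ w → f (c ∷ w)

  sumW-cong : ∀ m {f g} → (∀ w → length w ≡ m → f w ≈ g w) → sumW m f ≈ sumW m g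
  sumW-cong zero    f≈g = f≈g [] ≡.refl
  sumW-cong (suc m) f≈g =
    sum-cong-≋ λ c → sumW-cong m λ w eq → f≈g (c ∷ w) (≡.cong suc eq)

  sumW-++ : ∀ m n f → sumW (m ℕ.+ n) f ≈ sumW m λ u → sumW n λ v → f (u ++ v)
  sumW-++ zero    n f = refl
  sumW-++ (suc m) n f = sum-cong-≋ λ c → sumW-++ m n λ w → f (c ∷ w)

  sumW-scaleˡ : ∀ m a f → sumW m (λ w → a * f w) ≈ a * sumW m f
  sumW-scaleˡ zero    a f = refl
  sumW-scaleˡ (suc m) a f = trans (sum-cong-≋ λ c → sumW-scaleˡ m a λ w → f (c ∷ w))
    (sym (*-distribˡ-sum a λ c → sumW m λ w → f (c ∷ w)))

  sumW-scaleʳ : ∀ m a f → sumW m (λ w → f w * a) ≈ sumW m f * a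
  sumW-scaleʳ m a f = trans (sumW-cong m λ w _ → *-comm (f w) a)
    (trans (sumW-scaleˡ m a f) (*-comm a _))

  -- With its truth value taken in the semiring, properness becomes a product over edges, which can
  -- be factored out of sums.
  differ : Fin k → Fin k → Carrier
  differ c d = if does (c Fin.≟ d) then 0# else 1#

  differ-≢ : ∀ {c d} → c ≢ d → differ c d ≈ 1#
  differ-≢ {c} {d} neq with c Fin.≟ d
  ... | yes eq = contradiction eq neq
  ... | no _   = refl

  monomialOf : List (Fin k) → Carrier
  monomialOf = foldr (λ c y → x c * y) 1#

  monomialOf-++ : ∀ u v → monomialOf (u ++ v) ≈ monomialOf u * monomialOf v
  monomialOf-++ []      v = sym (*-identityˡ _)
  monomialOf-++ (c ∷ u) v = trans (*-congˡ (monomialOf-++ u v)) (sym (*-assoc _ _ _))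

  properOn : (ℕ → Fin k) → List (ℕ × ℕ) → Carrier
  properOn κ = foldr (λ (i , j) y → differ (κ i) (κ j) * y) 1#

  properOn-++ : ∀ κ es es′ → properOn κ (es ++ es′) ≈ properOn κ es * properOn κ es′
  properOn-++ κ []       es′ = sym (*-identityˡ _)
  properOn-++ κ (e ∷ es) es′ = trans (*-congˡ (properOn-++ κ es es′)) (sym (*-assoc _ _ _))

  ProperOn : (ℕ → Fin k) → List (ℕ × ℕ) → Set
  ProperOn κ = All λ (i , j) → κ i ≢ κ j

  properOn-yes : ∀ {κ es} → ProperOn κ es → properOn κ es ≈ 1#
  properOn-yes []       = refl
  properOn-yes (p ∷ ps) = trans (*-cong (differ-≢ p) (properOn-yes ps)) (*-identityˡ _)

  properOn-no : ∀ κ es → ¬ ProperOn κ es → properOn κ es ≈ 0#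
  properOn-no κ []             np = contradiction [] np
  properOn-no κ ((i , j) ∷ es) np with κ i Fin.≟ κ j
  ... | yes _ = zeroˡ _
  ... | no q  = trans (*-congˡ (properOn-no κ es λ ps → np (q ∷ ps))) (zeroʳ _)

  -- Sum of the weights of the proper colourings of a leg of length l attached
  -- to a vertex of colour c.
  leg : ℕ → Fin k → Carrier
  leg zero    c = 1#
  leg (suc l) c = ∑ λ d → differ c d * (x d * leg l d)

  path : ℕ → Carrier
  path zero    = 1#
  path (suc n) = ∑ λ c → x c * leg n c

  legs : List ℕ → Fin k → Carrier
  legs ls c = foldr (λ l y → leg l c * y) 1# ls

  chain : Fin k → List (Fin k) → Carrier
  chain c []      = 1#
  chain c (d ∷ w) = differ c d * (x d * chain d w)

  sumW-chain : ∀ l c → sumW l (chain c) ≈ leg l c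
  sumW-chain zero    c = refl
  sumW-chain (suc l) c = sum-cong-≋ λ d →
    trans (sumW-scaleˡ l (differ c d) λ w → x d * chain d w)
      (*-congˡ (trans (sumW-scaleˡ l (x d) (chain d)) (*-congˡ (sumW-chain l d))))

  -- The default `c` stands in for positions past the end of the word, which no edge of a spider
  -- reaches (`legsEdges-bounded`).
  nth : Fin k → List (Fin k) → ℕ → Fin k
  nth c []      i       = c
  nth c (d ∷ w) zero    = d
  nth c (d ∷ w) (suc i) = nth c w i

  Agree : (ℕ → Fin k) → ℕ → List (Fin k) → Set
  Agree κ s []      = ⊤
  Agree κ s (d ∷ u) = κ s ≡ d × Agree κ (suc s) u

  agree-suc : ∀ κ s u → Agree (κ ∘ suc) s u → Agree κ (suc s) u
  agree-suc κ s []      _       = tt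
  agree-suc κ s (d ∷ u) (p , q) = p , agree-suc κ (suc s) u q

  agree-nth : ∀ c pre u v → Agree (nth c (pre ++ (u ++ v))) (length pre) u
  agree-nth c []        []      v = tt
  agree-nth c []        (d ∷ u) v = ≡.refl , agree-suc _ 0 u (agree-nth c [] u v)
  agree-nth c (e ∷ pre) u       v = agree-suc _ (length pre) u (agree-nth c pre u v)

  -- `legEdges` lists the inner edges of a leg by their offset from its start; this recursive form
  -- follows the induction on a word.
  walk : ℕ → ℕ → List (ℕ × ℕ)
  walk s zero    = []
  walk s (suc l) = (s , suc s) ∷ walk (suc s) l

  applyUpTo-walk : ∀ s l f → (∀ i → f i ≡ (s ℕ.+ i , s ℕ.+ suc i)) → applyUpTo f l ≡ walk s l
  applyUpTo-walk s zero    f eq = ≡.refl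
  applyUpTo-walk s (suc l) f eq = ≡.cong₂ _∷_
    (≡.trans (eq 0) (≡.cong₂ _,_ (ℕ.+-identityʳ s) (ℕ.+-comm s 1)))
    (applyUpTo-walk (suc s) l (f ∘ suc) λ i →
      ≡.trans (eq (suc i)) (≡.cong₂ _,_ (ℕ.+-suc s i) (ℕ.+-suc s (suc i))))

  map-walk : ∀ s l → map (λ i → s ℕ.+ i , s ℕ.+ suc i) (upTo l) ≡ walk s l
  map-walk s l = ≡.trans (List.map-upTo _ l) (applyUpTo-walk s l _ λ _ → ≡.refl)

  properOn-walk : ∀ κ s d u → Agree κ s (d ∷ u) →
    properOn κ (walk s (length u)) * monomialOf u ≈ chain d u
  properOn-walk κ s d []      _              = *-identityˡ _
  properOn-walk κ s d (e ∷ u) (≡.refl , ≡.refl , q) = trans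
    (solve 4 (λ a b c d → a :* b :* (c :* d) := a :* (c :* (b :* d))) refl _ _ _ _)
    (*-congˡ (*-congˡ (properOn-walk κ (suc s) e u (≡.refl , q))))

  properOn-leg : ∀ κ s u → Agree κ s u →
    properOn κ (legEdges s (length u)) * monomialOf u ≈ chain (κ 0) u
  properOn-leg κ s []      _            = *-identityˡ _
  properOn-leg κ s (d ∷ u) (≡.refl , q) = begin
    differ (κ 0) d * properOn κ (map _ (upTo (length u))) * (x d * monomialOf u)
      ≡⟨ ≡.cong (λ es → differ (κ 0) d * properOn κ es * (x d * monomialOf u)) (map-walk s (length u)) ⟩
    differ (κ 0) d * properOn κ (walk s (length u)) * (x d * monomialOf u)
      ≈⟨ solve 4 (λ a b c d → a :* b :* (c :* d) := a :* (c :* (b :* d))) refl _ _ _ _ ⟩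
    differ (κ 0) d * (x d * (properOn κ (walk s (length u)) * monomialOf u))
      ≈⟨ *-congˡ (*-congˡ (properOn-walk κ s d u (≡.refl , q))) ⟩
    chain (κ 0) (d ∷ u) ∎

  -- Once the colour `c` of the centre is fixed, the legs no longer interact, so the sum over words
  -- is a product over legs. The induction carries along the colours `pre` of the legs already
  -- passed, since edges are given by absolute positions.
  sumW-legs : ∀ ls c pre →
    sumW (sum ls) (λ w → properOn (nth c (c ∷ pre ++ w)) (legsEdges (suc (length pre)) ls) * monomialOf w)
      ≈ legs ls c
  sumW-legs []       c pre = *-identityˡ _
  sumW-legs (l ∷ ls) c pre = begin
    sumW (l ℕ.+ sum ls) f
      ≈⟨ sumW-++ l (sum ls) f ⟩
    sumW l (λ u → sumW (sum ls) λ v → f (u ++ v))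
      ≈⟨ sumW-cong l (λ u eq → trans (sumW-cong (sum ls) λ v _ → split u eq v)
           (trans (sumW-scaleˡ (sum ls) (chain c u) _) (*-congˡ (sumW-legs ls c (pre ++ u))))) ⟩
    sumW l (λ u → chain c u * legs ls c)
      ≈⟨ sumW-scaleʳ l (legs ls c) (chain c) ⟩
    sumW l (chain c) * legs ls c
      ≈⟨ *-congʳ (sumW-chain l c) ⟩
    leg l c * legs ls c ∎
    where
    s = suc (length pre)

    f : List (Fin k) → Carrier
    f w = properOn (nth c (c ∷ pre ++ w)) (legsEdges s (l ∷ ls)) * monomialOf w

    split : ∀ u → length u ≡ l → ∀ v → f (u ++ v) ≈
      chain c u * (properOn (nth c (c ∷ (pre ++ u) ++ v)) (legsEdges (suc (length (pre ++ u))) ls) * monomialOf v)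
    split u ≡.refl v = begin
      properOn κ (legEdges s (length u) ++ legsEdges (s ℕ.+ length u) ls) * monomialOf (u ++ v)
        ≈⟨ *-cong (properOn-++ κ (legEdges s (length u)) _) (monomialOf-++ u v) ⟩
      properOn κ (legEdges s (length u)) * properOn κ (legsEdges (s ℕ.+ length u) ls) * (monomialOf u * monomialOf v)
        ≈⟨ solve 4 (λ a b c d → a :* b :* (c :* d) := a :* c :* (b :* d)) refl _ _ _ _ ⟩
      properOn κ (legEdges s (length u)) * monomialOf u * (properOn κ (legsEdges (s ℕ.+ length u) ls) * monomialOf v)
        ≈⟨ *-congʳ (properOn-leg κ s u (agree-nth c (c ∷ pre) u v)) ⟩
      chain c u * (properOn κ (legsEdges (s ℕ.+ length u) ls) * monomialOf v)
        ≡⟨ ≡.cong₂ (λ m w → chain c u * (properOn (nth c (c ∷ w)) (legsEdges (suc m) ls) * monomialOf v))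
             (≡.sym (List.length-++ pre)) (≡.sym (List.++-assoc pre u v)) ⟩
      chain c u * (properOn (nth c (c ∷ (pre ++ u) ++ v)) (legsEdges (suc (length (pre ++ u))) ls) * monomialOf v) ∎
      where
      κ = nth c (c ∷ pre ++ (u ++ v))

-- Series in finitely many variables as iterated power series

seriesSemiring : ℕ → CommutativeSemiring 0ℓ 0ℓ
seriesSemiring zero    = ℤ.+-*-commutativeSemiring
seriesSemiring (suc k) = PowerSeries.powerSeries (seriesSemiring k)

module Restricted (k : ℕ) = CommutativeSemiring (seriesSemiring k)

-- The part of a series in which only the variables x₀, …, xₖ₋₁ occur.
restrict : ∀ k → Series → Restricted.Carrier k
restrict zero    f   = f []
restrict (suc k) f n = restrict k λ α → f (n ∷ α)

variableOf : ∀ k → Fin k → Restricted.Carrier k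
variableOf (suc k) zero    = PowerSeries.z (seriesSemiring k)
variableOf (suc k) (suc c) = PowerSeries.constant (seriesSemiring k) (variableOf k c)

restrict-cong : ∀ k {f g} → (∀ α → length α ≡ k → f α ≡ g α) → Restricted._≈_ k (restrict k f) (restrict k g)
restrict-cong zero    f≡g   = f≡g [] ≡.refl
restrict-cong (suc k) f≡g n = restrict-cong k λ α eq → f≡g (n ∷ α) (≡.cong suc eq)

restrict-0 : ∀ k → Restricted._≈_ k (restrict k (λ _ → 0ℤ)) (Restricted.0# k)
restrict-0 zero    = ≡.refl
restrict-0 (suc k) n = restrict-0 k

restrict-+ : ∀ k f g →
  Restricted._≈_ k (restrict k (λ α → f α ℤ.+ g α)) (Restricted._+_ k (restrict k f) (restrict k g))
restrict-+ zero    f g   = ≡.refl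
restrict-+ (suc k) f g n = restrict-+ k (λ α → f (n ∷ α)) (λ α → g (n ∷ α))

monomial : ∀ k → (Fin k → ℕ) → Restricted.Carrier k
monomial zero    g   = 1ℤ
monomial (suc k) g n = if g zero ℕ.≡ᵇ n then monomial k (g ∘ suc) else Restricted.0# k

indicator : Monomial → Series
indicator β α = if does (List.≡-dec ℕ._≟_ β α) then 1ℤ else 0ℤ

restrict-indicator : ∀ k (g : Fin k → ℕ) →
  Restricted._≈_ k (restrict k (indicator (tabulate g))) (monomial k g)
restrict-indicator zero    g   = ≡.refl
restrict-indicator (suc k) g n with g zero ℕ.≡ᵇ n
... | true  = restrict-indicator k (g ∘ suc)
... | false = restrict-0 k

monomial-cong : ∀ k {g g′ : Fin k → ℕ} → (∀ i → g i ≡ g′ i) →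
  Restricted._≈_ k (monomial k g) (monomial k g′)
monomial-cong zero    eq = ≡.refl
monomial-cong (suc k) {g} {g′} eq n with g zero | eq zero
... | m | ≡.refl with m ℕ.≡ᵇ n
...   | true  = monomial-cong k λ i → eq (suc i)
...   | false = Restricted.refl k

monomial-0 : ∀ k → Restricted._≈_ k (monomial k λ _ → 0) (Restricted.1# k)
monomial-0 zero    = ≡.refl
monomial-0 (suc k) zero    = monomial-0 k
monomial-0 (suc k) (suc n) = Restricted.refl k

monomial-suc : ∀ k c {g g′ : Fin k → ℕ} → g′ c ≡ suc (g c) → (∀ i → i ≢ c → g′ i ≡ g i) →
  Restricted._≈_ k (monomial k g′) (Restricted._*_ k (variableOf k c) (monomial k g))
monomial-suc (suc k) zero {g} {g′} eq neq n with g′ zero | eq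
monomial-suc (suc k) zero {g} {g′} eq neq zero | _ | ≡.refl =
  Restricted.sym k (PowerSeries.z-⊗-zero (seriesSemiring k) (monomial (suc k) g))
monomial-suc (suc k) zero {g} {g′} eq neq (suc n) | _ | ≡.refl =
  Restricted.trans k lemma (Restricted.sym k (PowerSeries.z-⊗-suc (seriesSemiring k) (monomial (suc k) g) n))
  where
  lemma : Restricted._≈_ k (if g zero ℕ.≡ᵇ n then monomial k (g′ ∘ suc) else Restricted.0# k) (monomial (suc k) g n)
  lemma with g zero ℕ.≡ᵇ n
  ... | true  = monomial-cong k λ i → neq (suc i) (λ ())
  ... | false = Restricted.refl k
monomial-suc (suc k) (suc c) {g} {g′} eq neq n =
  Restricted.trans k lemma (Restricted.sym k
    (PowerSeries.constant-⊗ (seriesSemiring k) (variableOf k c) (monomial (suc k) g) n))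
  where
  lemma : Restricted._≈_ k (monomial (suc k) g′ n)
    (Restricted._*_ k (variableOf k c) (monomial (suc k) g n))
  lemma with g′ zero | neq zero (λ ())
  ... | _ | ≡.refl with g zero ℕ.≡ᵇ n
  ...   | true  = monomial-suc k c eq λ i i≢c → neq (suc i) λ { ≡.refl → i≢c ≡.refl }
  ...   | false = Restricted.sym k (Restricted.zeroʳ k _)

count : ∀ {n k} → (Fin n → Fin k) → Fin k → ℕ
count {zero}  κ i = 0
count {suc n} κ i = if does (κ zero Fin.≟ i) then suc (count (κ ∘ suc) i) else count (κ ∘ suc) i

length-filter : ∀ {m n k} (κ : Fin m → Fin k) i (f : Fin n → Fin m) →
  length (filter (λ v → κ v Fin.≟ i) (tabulate f)) ≡ count (κ ∘ f) i
length-filter {n = zero}  κ i f = ≡.refl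
length-filter {n = suc n} κ i f with does (κ (f zero) Fin.≟ i)
... | true  = ≡.cong suc (length-filter κ i (f ∘ suc))
... | false = length-filter κ i (f ∘ suc)

monomial-count : ∀ k {n} (κ : Fin n → Fin k) →
  Restricted._≈_ k (monomial k (count κ)) (Words.monomialOf (seriesSemiring k) (variableOf k) (tabulate κ))
monomial-count k {zero}  κ = monomial-0 k
monomial-count k {suc n} κ = Restricted.trans k
  (monomial-suc k (κ zero) here elsewhere)
  (Restricted.*-congˡ k (monomial-count k (κ ∘ suc)))
  where
  here : count κ (κ zero) ≡ suc (count (κ ∘ suc) (κ zero))
  here with κ zero Fin.≟ κ zero
  ... | yes _ = ≡.refl
  ... | no ne = contradiction ≡.refl ne

  elsewhere : ∀ i → i ≢ κ zero → count κ i ≡ count (κ ∘ suc) i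
  elsewhere i ne with κ zero Fin.≟ i
  ... | yes eq = contradiction (≡.sym eq) ne
  ... | no _   = ≡.refl

-- Sums over encoded colourings

module Enumeration (S : CommutativeSemiring 0ℓ 0ℓ) where
  open CommutativeSemiring S hiding (zero)
  open import Algebra.Properties.Semiring.Sum semiring
    renaming (sum to ∑) using (sum-cong-≋)
  open SetoidReasoning setoid

  ∑-split : ∀ m {n} (f : Fin (m ℕ.+ n) → Carrier) → ∑ f ≈ ∑ (λ i → f (i ↑ˡ n)) + ∑ (λ j → f (m ↑ʳ j))
  ∑-split zero    f = sym (+-identityˡ _)
  ∑-split (suc m) f = trans (+-congˡ (∑-split m (f ∘ suc))) (sym (+-assoc _ _ _))

  -- `finToFun` decodes its first value from a quotient and the others from the remainder, so this
  -- splits a sum over codes of colourings into a sum over the first letter and one over the rest.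
  ∑-quotRem : ∀ m n (h : Fin m → Fin n → Carrier) →
    ∑ (λ i → h (quotient n i) (remainder {m} n i)) ≈ ∑ λ c → ∑ (h c)
  ∑-quotRem zero    n h = refl
  ∑-quotRem (suc m) n h = trans (∑-split n {m ℕ.* n} _) (+-cong
    (sum-cong-≋ {n} λ i → reflexive (first i))
    (trans (sum-cong-≋ {m ℕ.* n} λ j → reflexive (rest j)) (∑-quotRem m n (h ∘ suc))))
    where
    first : ∀ i → h (quotient {suc m} n (i ↑ˡ m ℕ.* n)) (remainder {suc m} n (i ↑ˡ m ℕ.* n)) ≡ h zero i
    first i rewrite Fin.splitAt-↑ˡ n i (m ℕ.* n) = ≡.refl

    rest : ∀ j → h (quotient {suc m} n (n ↑ʳ j)) (remainder {suc m} n (n ↑ʳ j))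
                   ≡ h (suc (quotient n j)) (remainder {m} n j)
    rest j rewrite Fin.splitAt-↑ʳ n (m ℕ.* n) j = ≡.refl

  ∑-finToFun : ∀ {k} (x : Fin k → Carrier) n (f : List (Fin k) → Carrier) →
    ∑ {k ℕ.^ n} (λ i → f (tabulate (finToFun {k} {n} i))) ≈ Words.sumW S x n f
  ∑-finToFun         x zero    f = +-identityʳ _
  ∑-finToFun {k}     x (suc n) f = trans
    (∑-quotRem k (k ℕ.^ n) λ c j → f (c ∷ tabulate (finToFun {k} {n} j)))
    (sum-cong-≋ λ c → ∑-finToFun x n λ w → f (c ∷ w))

legEdges-bounded : ∀ s l → 0 < s → All (λ (i , j) → i < s ℕ.+ l × j < s ℕ.+ l) (legEdges s l)
legEdges-bounded s zero    0<s = []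
legEdges-bounded s (suc l) 0<s =
  (ℕ.≤-trans 0<s (ℕ.m≤m+n s (suc l)) , ℕ.m<m+n s (s≤s z≤n)) ∷
  All.map⁺ (All.applyUpTo⁺₁ id l λ {i} i<l →
    ℕ.+-monoʳ-< s (ℕ.m≤n⇒m≤1+n i<l) , ℕ.+-monoʳ-< s (s≤s i<l))

-- Edges are pairs of natural numbers, whereas `Proper` ranges over vertices in `Fin`; the bound
-- turns the ends of an edge into vertices.
legsEdges-bounded : ∀ s ls → 0 < s → All (λ (i , j) → i < s ℕ.+ sum ls × j < s ℕ.+ sum ls) (legsEdges s ls)
legsEdges-bounded s []       0<s = []
legsEdges-bounded s (l ∷ ls) 0<s = All.++⁺
  (All.map (λ (p , q) → weaken p , weaken q) (legEdges-bounded s l 0<s))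
  (≡.subst (λ m → All (λ (i , j) → i < m × j < m) (legsEdges (s ℕ.+ l) ls)) (ℕ.+-assoc s l (sum ls))
    (legsEdges-bounded (s ℕ.+ l) ls (ℕ.≤-trans 0<s (ℕ.m≤m+n s l))))
  where
  weaken : ∀ {i} → i < s ℕ.+ l → i < s ℕ.+ (l ℕ.+ sum ls)
  weaken p = ℕ.<-≤-trans p (ℕ.+-monoʳ-≤ s (ℕ.m≤m+n l (sum ls)))

length-filter-sumℤ : ∀ {A : Set} {P : A → Set} (P? : ∀ x → Dec (P x)) xs →
  + length (filter P? xs) ≡ sumℤ (map (λ x → if does (P? x) then 1ℤ else 0ℤ) xs)
length-filter-sumℤ P? []       = ≡.refl
length-filter-sumℤ P? (x ∷ xs) with does (P? x)
... | true  = ≡.cong (ℤ._+_ 1ℤ) (length-filter-sumℤ P? xs)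
... | false = ≡.trans (length-filter-sumℤ P? xs) (≡.sym (ℤ.+-identityˡ _))

-- The chromatic symmetric function of a spider in k variables

module Chromatic (k : ℕ) where
  open Restricted k hiding (zero)
  open import Algebra.Properties.Semiring.Sum semiring
    renaming (sum to ∑) using (sum-cong-≋)
  open Words (seriesSemiring k) (variableOf k)
  open Enumeration (seriesSemiring k)
  open SetoidReasoning setoid

  restrict-sumℤ : ∀ {N} (F : Fin N → Series) →
    restrict k (λ α → sumℤ (tabulate λ i → F i α)) ≈ ∑ λ i → restrict k (F i)
  restrict-sumℤ {zero}  F = restrict-0 k
  restrict-sumℤ {suc N} F = trans (restrict-+ k (F zero) _) (+-congˡ (restrict-sumℤ (F ∘ suc)))

  module _ (ls : List ℕ) where
    private
      G = spider ls
      n N : ℕ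
      n = suc (sum ls)
      N = k ℕ.^ n
      es = legsEdges 1 ls

    -- A spider has a centre, so the empty word never occurs and its value is a dummy.
    term : List (Fin k) → Carrier
    term []      = 0#
    term (c ∷ w) = properOn (nth c (c ∷ w)) es * monomialOf (c ∷ w)

    nth-tabulate : ∀ {N} (f : Fin N → Fin k) c i → nth c (tabulate f) (toℕ i) ≡ f i
    nth-tabulate f c zero    = ≡.refl
    nth-tabulate f c (suc i) = nth-tabulate (f ∘ suc) c i

    module _ (κ : Colouring G k) where
      colour : ℕ → Fin k
      colour = nth (κ zero) (tabulate κ)

      proper⇒properOn : Proper G κ → ProperOn colour es
      proper⇒properOn p = All.tabulate λ { {i , j} e → differ′ e (All.lookup (legsEdges-bounded 1 ls (s≤s z≤n)) e) }
        where
        differ′ : ∀ {i j} → (i , j) ∈ es → i < n × j < n → colour i ≢ colour j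
        differ′ {i} {j} e (i<n , j<n) eq = p (fromℕ< i<n) (fromℕ< j<n)
          (inj₁ (≡.subst₂ (λ i j → (i , j) ∈ es) (≡.sym (Fin.toℕ-fromℕ< i<n)) (≡.sym (Fin.toℕ-fromℕ< j<n)) e))
          (≡.trans (≡.sym (at i<n)) (≡.trans eq (at j<n)))
          where
          at : ∀ {i} (i<n : i < n) → colour i ≡ κ (fromℕ< i<n)
          at i<n = ≡.trans (≡.cong colour (≡.sym (Fin.toℕ-fromℕ< i<n))) (nth-tabulate κ (κ zero) (fromℕ< i<n))

      properOn⇒proper : ProperOn colour es → Proper G κ
      properOn⇒proper p u v (inj₁ e) eq = All.lookup p e
        (≡.trans (nth-tabulate κ (κ zero) u) (≡.trans eq (≡.sym (nth-tabulate κ (κ zero) v))))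
      properOn⇒proper p u v (inj₂ e) eq = All.lookup p e
        (≡.trans (nth-tabulate κ (κ zero) v) (≡.trans (≡.sym eq) (≡.sym (nth-tabulate κ (κ zero) u))))

      weight-count : weight G κ ≡ tabulate (count κ)
      weight-count = List.tabulate-cong λ i → length-filter κ i id

      restrict-colouring : (p? : Dec (Proper G κ)) →
        restrict k (λ α → if does (p? ×-dec List.≡-dec ℕ._≟_ (weight G κ) α) then 1ℤ else 0ℤ)
          ≈ term (tabulate κ)
      restrict-colouring (yes p) = begin
        restrict k (indicator (weight G κ))            ≡⟨ ≡.cong (restrict k ∘ indicator) weight-count ⟩
        restrict k (indicator (tabulate (count κ)))    ≈⟨ restrict-indicator k (count κ) ⟩
        monomial k (count κ)                           ≈⟨ monomial-count k κ ⟩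
        monomialOf (tabulate κ)                        ≈⟨ *-identityˡ _ ⟨
        1# * monomialOf (tabulate κ)                   ≈⟨ *-congʳ (properOn-yes (proper⇒properOn p)) ⟨
        term (tabulate κ)                              ∎
      restrict-colouring (no np) = begin
        restrict k (λ _ → 0ℤ)                          ≈⟨ restrict-0 k ⟩
        0#                                             ≈⟨ zeroˡ _ ⟨
        0# * monomialOf (tabulate κ)                   ≈⟨ *-congʳ (properOn-no colour es λ q → np (properOn⇒proper q)) ⟨
        term (tabulate κ)                              ∎

    colouringOf : Fin N → Colouring G k
    colouringOf = finToFun {k} {n}

    contribution : Colouring G k → Series
    contribution κ α = if does (proper? G κ ×-dec List.≡-dec ℕ._≟_ (weight G κ) α) then 1ℤ else 0ℤ

    -- `chromatic` takes its number of colours from the length of the exponent list, so the part in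
    -- k variables sees exactly the colourings with k colours.
    chromatic-sumℤ : ∀ α → length α ≡ k → chromatic G α ≡ sumℤ (tabulate {n = N} λ i → contribution (colouringOf i) α)
    chromatic-sumℤ α ≡.refl = ≡.trans
      (length-filter-sumℤ (λ κ → proper? G κ ×-dec List.≡-dec ℕ._≟_ (weight G κ) α) (colourings G k))
      (≡.cong sumℤ (≡.trans
        (≡.sym (List.map-∘ {g = λ κ → contribution κ α} {f = colouringOf} (allFin N)))
        (List.map-tabulate {n = N} id λ i → contribution (colouringOf i) α)))

    restrict-chromatic : restrict k (chromatic G) ≈ ∑ λ c → variableOf k c * legs ls c
    restrict-chromatic = begin
      restrict k (chromatic G)
        ≈⟨ restrict-cong k chromatic-sumℤ ⟩
      restrict k (λ α → sumℤ (tabulate {n = N} λ i → contribution (colouringOf i) α))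
        ≈⟨ restrict-sumℤ {N} (λ i → contribution (colouringOf i)) ⟩
      ∑ {N} (λ i → restrict k (contribution (colouringOf i)))
        ≈⟨ sum-cong-≋ {N} (λ i → restrict-colouring (colouringOf i) (proper? G (colouringOf i))) ⟩
      ∑ {N} (λ i → term (tabulate (colouringOf i)))
        ≈⟨ ∑-finToFun (variableOf k) n term ⟩
      sumW n term
        ≈⟨ sum-cong-≋ (λ c → trans (sumW-cong (sum ls) λ w _ → swap c w)
             (trans (sumW-scaleˡ (sum ls) (variableOf k c) _) (*-congˡ (sumW-legs ls c [])))) ⟩
      ∑ (λ c → variableOf k c * legs ls c) ∎
      where
      swap : ∀ c w → term (c ∷ w) ≈ variableOf k c * (properOn (nth c (c ∷ w)) es * monomialOf w)
      swap c w = trans (sym (*-assoc _ _ _)) (trans (*-congʳ (*-comm _ _)) (*-assoc _ _ _))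

-- Elementary symmetric polynomials and paths

module Elementary (S : CommutativeSemiring 0ℓ 0ℓ) where
  open CommutativeSemiring S hiding (zero)
  open import Algebra.Properties.Semiring.Mult semiring using (×-comm-*) renaming (_×_ to _·_)
  open import Algebra.Properties.CommutativeMonoid.Mult +-commutativeMonoid using (×-distrib-+)
  open import Algebra.Properties.Semiring.Sum semiring
    renaming (sum to ∑) using (sum-cong-≋; ∑-distrib-+; *-distribˡ-sum)
  open PowerSeries S hiding (tail)

  elem : ∀ {k} → (Fin k → Carrier) → ℕ → Carrier
  elem         x zero    = 1#
  elem {zero}  x (suc j) = 0#
  elem {suc k} x (suc j) = elem (x ∘ suc) (suc j) + x zero * elem (x ∘ suc) j

  -- z E′(z), where E is the generating function of the elementary polynomials.
  weighted : ∀ {k} → (Fin k → Carrier) → ℕ → Carrier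
  weighted x j = j · elem x j

  infixl 7 _·z⊗_
  _·z⊗_ : Carrier → PS → PS
  (a ·z⊗ f) zero    = 0#
  (a ·z⊗ f) (suc n) = a * f n

  ·z⊗-assoc : ∀ a f g → a ·z⊗ f ⊗ g ≋ a ·z⊗ (f ⊗ g)
  ·z⊗-assoc a f g zero    = zeroˡ _
  ·z⊗-assoc a f g (suc n) = trans (+-cong (zeroˡ _) (⊗-scale a f g n)) (+-identityˡ _)

  elem-cons : ∀ {k} (x : Fin (suc k) → Carrier) → elem x ≋ elem (x ∘ suc) ⊕ x zero ·z⊗ elem (x ∘ suc)
  elem-cons x zero    = sym (+-identityʳ _)
  elem-cons x (suc j) = refl

  weighted-cons : ∀ {k} (x : Fin (suc k) → Carrier) →
    weighted x ≋ weighted (x ∘ suc) ⊕ x zero ·z⊗ (elem (x ∘ suc) ⊕ weighted (x ∘ suc))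
  weighted-cons x zero    = sym (+-identityʳ _)
  weighted-cons x (suc j) = trans (×-distrib-+ _ _ (suc j)) (+-congˡ (sym (×-comm-* (suc j) (x zero) _)))

  -- This is Σ_c x_c z q_c. When q_c is the generating function of the legs at a vertex of colour c,
  -- it is the path series without its constant term.
  marked : ∀ {k} → (Fin k → Carrier) → (Fin k → PS) → PS
  marked {zero}  x q = λ _ → 0#
  marked {suc k} x q = x zero ·z⊗ q zero ⊕ marked (x ∘ suc) (q ∘ suc)

  marked-zero : ∀ {k} (x : Fin k → Carrier) q → marked x q 0 ≈ 0#
  marked-zero {zero}  x q = refl
  marked-zero {suc k} x q = trans (+-identityˡ _) (marked-zero (x ∘ suc) (q ∘ suc))

  marked-suc : ∀ {k} (x : Fin k → Carrier) q n → marked x q (suc n) ≈ ∑ λ c → x c * q c n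
  marked-suc {zero}  x q n = refl
  marked-suc {suc k} x q n = +-congˡ (marked-suc (x ∘ suc) (q ∘ suc) n)

  private
    module PSR = CommutativeSemiring powerSeries

  module _ where
    open import Algebra.Solver.Ring.NaturalCoefficients.Default powerSeries
      using (solve; _:+_; _:*_; _:=_)
    open SetoidReasoning PSR.setoid

    -- As (1 + x_c z) q_c = P, this is E′/E = Σ_c x_c/(1 + x_c z) multiplied by z E P.
    elem-marked : ∀ {k} (x : Fin k → Carrier) q p → (∀ c → q c ⊕ x c ·z⊗ q c ≋ p) →
      elem x ⊗ marked x q ≋ weighted x ⊗ p
    elem-marked {zero}  x q p eq = PSR.trans (PSR.zeroʳ (elem x)) (PSR.sym
      (PSR.trans (PSR.*-congʳ {p} {weighted x} {PSR.0#} λ { zero → refl ; (suc j) → ×-zero (suc j) }) (PSR.zeroˡ p)))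
      where
      ×-zero : ∀ j → j · 0# ≈ 0#
      ×-zero zero    = refl
      ×-zero (suc j) = trans (+-identityˡ _) (×-zero j)
    elem-marked {suc k} x q p eq = begin
      elem x ⊗ marked x q
        ≈⟨ PSR.*-cong {elem x} {e ⊕ t ⊗ e} {marked x q} {t ⊗ q₀ ⊕ s}
             (PSR.trans (elem-cons x) (PSR.+-congˡ {e} (factor e))) (PSR.+-congʳ {s} (factor q₀)) ⟩
      (e ⊕ t ⊗ e) ⊗ (t ⊗ q₀ ⊕ s)
        ≈⟨ solve 4 (λ e t q s → (e :+ t :* e) :* (t :* q :+ s)
             := t :* e :* (q :+ t :* q) :+ (e :* s :+ t :* (e :* s))) PSR.refl e t q₀ s ⟩
      t ⊗ e ⊗ (q₀ ⊕ t ⊗ q₀) ⊕ (e ⊗ s ⊕ t ⊗ (e ⊗ s))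
        ≈⟨ PSR.+-cong (PSR.*-congˡ {t ⊗ e} (PSR.trans (PSR.+-congˡ {q₀} (PSR.sym (factor q₀))) (eq zero)))
             (PSR.+-cong ih (PSR.*-congˡ {t} ih)) ⟩
      t ⊗ e ⊗ p ⊕ (w ⊗ p ⊕ t ⊗ (w ⊗ p))
        ≈⟨ solve 4 (λ e t w p → t :* e :* p :+ (w :* p :+ t :* (w :* p)) := (w :+ t :* (e :+ w)) :* p) PSR.refl e t w p ⟩
      (w ⊕ t ⊗ (e ⊕ w)) ⊗ p
        ≈⟨ PSR.*-congʳ {p} (PSR.sym (PSR.trans (weighted-cons x) (PSR.+-congˡ {w} (factor (e ⊕ w))))) ⟩
      weighted x ⊗ p ∎
      where
      e = elem (x ∘ suc)
      w = weighted (x ∘ suc)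
      q₀ = q zero
      s = marked (x ∘ suc) (q ∘ suc)
      t = x zero ·z⊗ constant 1#

      ih : e ⊗ s ≋ w ⊗ p
      ih = elem-marked (x ∘ suc) (q ∘ suc) p (eq ∘ suc)

      factor : ∀ f → x zero ·z⊗ f ≋ t ⊗ f
      factor f = PSR.sym (PSR.trans (·z⊗-assoc (x zero) (constant 1#) f)
        λ { zero → refl ; (suc n) → *-congˡ (⊗-identityˡ f n) })

  ∑-differ : ∀ {k} (c : Fin k) (f : Fin k → Carrier) →
    ∑ (λ d → (if does (c Fin.≟ d) then 0# else 1#) * f d) + f c ≈ ∑ f
  ∑-differ zero f = trans
    (+-congʳ (trans (+-cong (zeroˡ _) (sum-cong-≋ λ d → *-identityˡ (f (suc d)))) (+-identityˡ _)))
    (+-comm _ _)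
  ∑-differ (suc c) f = trans (+-assoc _ _ _) (+-cong (*-identityˡ _) (∑-differ c (f ∘ suc)))

  module _ {k} (+-cancelʳ : RightCancellative _≈_ _+_) (x : Fin k → Carrier) where
    open Words S x using (leg; path; legs)
    open import Algebra.Solver.Ring.NaturalCoefficients.Default S
      using (solve; _:+_; _:*_; _:=_)
    open SetoidReasoning setoid

    -- Without the condition on the edge to the centre, a leg is a free path; the colourings that
    -- violate the condition are those whose first vertex has colour `c`.
    leg-suc : ∀ l c → leg (suc l) c + x c * leg l c ≈ path (suc l)
    leg-suc l c = ∑-differ c λ d → x d * leg l d

    -- Comparing coefficients in E P = E + z E′ P.
    path-suc : ∀ n → path (suc n) ≈ elem x (suc n) + ((λ i → i · elem x (suc i)) ⊗ path) n
    path-suc n = +-cancelʳ r _ _ (begin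
      path (suc n) + r
        ≈⟨ +-congʳ (*-identityˡ _) ⟨
      (elem x ⊗ path) (suc n)
        ≈⟨ E⊗P (suc n) ⟩
      elem x (suc n) + (weighted x ⊗ path) (suc n)
        ≈⟨ +-congˡ (trans
             (+-cong (zeroˡ _) (⊗-distribʳ path (elem x ∘ suc) (λ i → i · elem x (suc i)) n)) (+-identityˡ _)) ⟩
      elem x (suc n) + (r + ((λ i → i · elem x (suc i)) ⊗ path) n)
        ≈⟨ solve 3 (λ a b c → a :+ (b :+ c) := a :+ c :+ b) refl _ _ _ ⟩
      elem x (suc n) + ((λ i → i · elem x (suc i)) ⊗ path) n + r ∎)
      where
      r = ((elem x ∘ suc) ⊗ path) n

      q : Fin k → PS
      q c n = leg n c

      P≋ : path ≋ constant 1# ⊕ marked x q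
      P≋ zero    = sym (trans (+-congˡ (marked-zero x q)) (+-identityʳ _))
      P≋ (suc n) = sym (trans (+-identityˡ _) (marked-suc x q n))

      E⊗P : elem x ⊗ path ≋ elem x ⊕ weighted x ⊗ path
      E⊗P = PSR.trans (PSR.*-congˡ {elem x} P≋) (PSR.trans (PSR.distribˡ (elem x) (constant 1#) (marked x q))
        (PSR.+-cong {elem x ⊗ constant 1#} (PSR.*-identityʳ (elem x))
          (elem-marked x q path λ { c zero → +-identityʳ _ ; c (suc l) → leg-suc l c })))

    private
      -- Paths with a marked vertex, whose removal leaves a and b vertices.
      F : ℕ → ℕ → Carrier
      F a b = ∑ λ c → x c * (leg a c * leg b c)

      -- Pairs of paths with a + 1 and b + 1 vertices whose first vertices have the same colour.
      G : ℕ → ℕ → Carrier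
      G a b = ∑ λ c → x c * (x c * (leg a c * leg b c))

    -- Two paths whose first vertices differ in colour join into one path with a marked vertex; the
    -- remaining pairs are counted by `G`.
    F-suc : ∀ a b → F (suc a) b + G a b ≈ path (suc a) * path (suc b)
    F-suc a b = begin
      F (suc a) b + G a b
        ≈⟨ ∑-distrib-+ {k} (λ c → x c * (leg (suc a) c * leg b c)) _ ⟨
      ∑ (λ c → x c * (leg (suc a) c * leg b c) + x c * (x c * (leg a c * leg b c)))
        ≈⟨ sum-cong-≋ {k} (λ c → trans
             (solve 4 (λ x l m b → x :* (m :* b) :+ x :* (x :* (l :* b)) := (m :+ x :* l) :* (x :* b)) refl _ _ _ _)
             (*-congʳ (leg-suc a c))) ⟩
      ∑ (λ c → path (suc a) * (x c * leg b c))
        ≈⟨ *-distribˡ-sum {k} (path (suc a)) (λ c → x c * leg b c) ⟨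
      path (suc a) * path (suc b) ∎

    F-comm : ∀ a b → F a b ≈ F b a
    F-comm a b = sum-cong-≋ {k} λ c → *-congˡ (*-comm _ _)

    G-comm : ∀ a b → G a b ≈ G b a
    G-comm a b = sum-cong-≋ {k} λ c → *-congˡ (*-congˡ (*-comm _ _))

    -- By `F-suc`, both `F (suc a) b` and `F a (suc b)` complement the same `G a b` to the same
    -- product. Hence the marked vertex may be moved along the path until it is an end.
    F-path : ∀ a b → F a b ≈ path (suc (a ℕ.+ b))
    F-path zero    b = sum-cong-≋ {k} λ c → *-congˡ (*-identityˡ _)
    F-path (suc a) b = trans (+-cancelʳ (G a b) _ _ (begin
      F (suc a) b + G a b            ≈⟨ F-suc a b ⟩
      path (suc a) * path (suc b)    ≈⟨ *-comm _ _ ⟩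
      path (suc b) * path (suc a)    ≈⟨ F-suc b a ⟨
      F (suc b) a + G b a            ≈⟨ +-cong (F-comm (suc b) a) (G-comm b a) ⟩
      F a (suc b) + G a b            ∎))
      (trans (F-path a (suc b)) (reflexive (≡.cong (path ∘ suc) (ℕ.+-suc a b))))

    -- Detach the leg of length 1. A free vertex beside a path with marked vertex either differs
    -- from it in colour, which gives the spider, or agrees with it, which gives `G a b`; `F-suc`
    -- exchanges this `G a b` for the product of two paths.
    spider-path : ∀ a b →
      ∑ (λ c → x c * legs (a ∷ b ∷ 1 ∷ []) c) + path (suc a) * path (suc b)
        ≈ path (suc (suc (a ℕ.+ b))) + path 1 * path (suc (a ℕ.+ b))
    spider-path a b = begin
      ∑ (λ c → x c * legs (a ∷ b ∷ 1 ∷ []) c) + path (suc a) * path (suc b)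
        ≈⟨ +-congˡ (F-suc a b) ⟨
      ∑ (λ c → x c * legs (a ∷ b ∷ 1 ∷ []) c) + (F (suc a) b + G a b)
        ≈⟨ solve 3 (λ s f g → s :+ (f :+ g) := f :+ (s :+ g)) refl _ _ _ ⟩
      F (suc a) b + (∑ (λ c → x c * legs (a ∷ b ∷ 1 ∷ []) c) + G a b)
        ≈⟨ +-congˡ (∑-distrib-+ {k} (λ c → x c * legs (a ∷ b ∷ 1 ∷ []) c) _) ⟨
      F (suc a) b + ∑ (λ c → x c * legs (a ∷ b ∷ 1 ∷ []) c + x c * (x c * (leg a c * leg b c)))
        ≈⟨ +-cong (F-path (suc a) b) (sum-cong-≋ {k} λ c → trans
             (solve 5 (λ o x l m r → x :* (l :* (m :* (r :* o))) :+ x :* (x :* (l :* m))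
               := (r :* o :+ x) :* (x :* (l :* m))) refl 1# _ _ _ _)
             (*-congʳ (trans (+-cong (*-identityʳ _) (sym (*-identityʳ _))) (leg-suc 0 c)))) ⟩
      path (suc (suc (a ℕ.+ b))) + ∑ (λ c → path 1 * (x c * (leg a c * leg b c)))
        ≈⟨ +-congˡ (*-distribˡ-sum {k} (path 1) (λ c → x c * (leg a c * leg b c))) ⟨
      path (suc (suc (a ℕ.+ b))) + path 1 * F a b
        ≈⟨ +-congˡ (*-congˡ (F-path a b)) ⟩
      path (suc (suc (a ℕ.+ b))) + path 1 * path (suc (a ℕ.+ b)) ∎

-- Elementary symmetric polynomials in k variables

module _ (S : CommutativeSemiring 0ℓ 0ℓ) where
  open CommutativeSemiring S hiding (zero)
  open PowerSeries S hiding (tail)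
  private
    module PSR = CommutativeSemiring powerSeries

  constant-cong : ∀ {a b} → a ≈ b → constant a ≋ constant b
  constant-cong eq zero    = eq
  constant-cong eq (suc n) = refl

  constant-+ : ∀ a b → constant (a + b) ≋ constant a ⊕ constant b
  constant-+ a b zero    = refl
  constant-+ a b (suc n) = sym (+-identityʳ _)

  constant-* : ∀ a b → constant (a * b) ≋ constant a ⊗ constant b
  constant-* a b zero    = refl
  constant-* a b (suc n) = sym (trans (constant-⊗ a (constant b) (suc n)) (zeroʳ a))

  elem-constant : ∀ {k} (x : Fin k → Carrier) j →
    Elementary.elem powerSeries (constant ∘ x) j ≋ constant (Elementary.elem S x j)
  elem-constant         x zero    = PSR.refl {constant 1#}
  elem-constant {zero}  x (suc j) = λ { zero → refl ; (suc n) → refl }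
  elem-constant {suc k} x (suc j) = PSR.sym (PSR.trans (constant-+ _ _)
    (PSR.+-cong (PSR.sym (elem-constant (x ∘ suc) (suc j)))
      (PSR.trans (constant-* (x zero) _) (PSR.*-congˡ {constant (x zero)} (PSR.sym (elem-constant (x ∘ suc) j))))))

  elem->-0 : ∀ {k} (x : Fin k → Carrier) j → k < j → Elementary.elem S x j ≈ 0#
  elem->-0 {zero}  x (suc j) k<j       = refl
  elem->-0 {suc k} x (suc j) (s≤s k<j) = trans
    (+-cong (elem->-0 (x ∘ suc) (suc j) (ℕ.m<n⇒m<1+n k<j)) (trans (*-congˡ (elem->-0 (x ∘ suc) j k<j)) (zeroʳ _)))
    (+-identityʳ _)

elemOf : ∀ k → ℕ → Restricted.Carrier k
elemOf k = Elementary.elem (seriesSemiring k) (variableOf k)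

module _ (k : ℕ) where
  open Restricted k hiding (zero)
  open PowerSeries (seriesSemiring k) hiding (tail)
  private
    module PSR = CommutativeSemiring powerSeries

  elemOf-suc : ∀ j → elemOf (suc k) (suc j) ≋ constant (elemOf k (suc j)) ⊕ z ⊗ constant (elemOf k j)
  elemOf-suc j = PSR.+-cong (elem-constant (seriesSemiring k) (variableOf k) (suc j))
    (PSR.*-congˡ {z} (elem-constant (seriesSemiring k) (variableOf k) j))

  elemOf-at-0 : ∀ j → elemOf (suc k) j 0 ≈ elemOf k j
  elemOf-at-0 zero    = refl
  elemOf-at-0 (suc j) = trans (elemOf-suc j 0) (trans (+-congˡ (z-⊗-zero (constant (elemOf k j)))) (+-identityʳ _))

  elemOf-at-1 : ∀ j → elemOf (suc k) (suc j) 1 ≈ elemOf k j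
  elemOf-at-1 j = trans (elemOf-suc j 1) (trans (+-congˡ (z-⊗-suc (constant _) 0)) (+-identityˡ _))

  elemOf-at-2+ : ∀ j n → elemOf (suc k) j (suc (suc n)) ≈ 0#
  elemOf-at-2+ zero    n = refl
  elemOf-at-2+ (suc j) n = trans (elemOf-suc j (suc (suc n)))
    (trans (+-congˡ (z-⊗-suc (constant _) (suc n))) (+-identityˡ _))

  elemOf-top : elemOf (suc k) (suc k) ≋ z ⊗ constant (elemOf k k)
  elemOf-top = PSR.trans (elemOf-suc k) (PSR.trans
    (PSR.+-congʳ {z ⊗ constant (elemOf k k)} (PSR.trans
      (constant-cong (seriesSemiring k) (elem->-0 (seriesSemiring k) (variableOf k) (suc k) ℕ.≤-refl))
      λ { zero → refl ; (suc n) → refl }))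
    (PSR.+-identityˡ _))

-- In k variables e_k is the product of all variables, and multiplying by a variable merely shifts
-- coefficients.
elemOf-top-cancel : ∀ k f g → let open Restricted k in
  elemOf k k * f ≈ elemOf k k * g → f ≈ g
elemOf-top-cancel zero    f g eq = ≡.trans (≡.sym (ℤ.*-identityˡ f)) (≡.trans eq (ℤ.*-identityˡ g))
elemOf-top-cancel (suc k) f g eq n = elemOf-top-cancel k (f n) (g n)
  (trans (sym (coefficient f)) (trans (eq (suc n)) (coefficient g)))
  where
  open Restricted k hiding (zero)
  open PowerSeries (seriesSemiring k)
  module PSR = CommutativeSemiring powerSeries
  coefficient : ∀ f → (elemOf (suc k) (suc k) ⊗ f) (suc n) ≈ elemOf k k * f n
  coefficient f = trans (PSR.*-congʳ {f} (elemOf-top k) (suc n))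
    (trans (PSR.*-assoc z (constant (elemOf k k)) f (suc n))
      (trans (z-⊗-suc (constant (elemOf k k) ⊗ f) n) (constant-⊗ (elemOf k k) f n)))

restrict-elementary : ∀ k j → let open Restricted k in
  restrict k (elementary j) ≈ elemOf k j
restrict-elementary zero    zero    = ≡.refl
restrict-elementary zero    (suc j) = ≡.refl
restrict-elementary (suc k) j zero    =
  trans (restrict-elementary k j) (sym (elemOf-at-0 k j))
  where open Restricted k hiding (zero)
restrict-elementary (suc k) zero (suc zero) =
  -- An exponent 1 already rules out degree 0, but it leaves the squarefree half of the test
  -- undecided.
  trans (restrict-cong k λ α _ → ≡.cong (if_then 1ℤ else 0ℤ) (∧-zeroʳ (does (All.all? (ℕ._≤? 1) α)))) (restrict-0 k)
  where open Restricted k hiding (zero)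
restrict-elementary (suc k) (suc j) (suc zero) =
  trans (restrict-elementary k j) (sym (elemOf-at-1 k j))
  where open Restricted k hiding (zero)
restrict-elementary (suc k) j (suc (suc n)) = trans (restrict-0 k) (sym (elemOf-at-2+ k j n))
  where open Restricted k hiding (zero)

sumℤ-++ : ∀ xs ys → sumℤ (xs ++ ys) ≡ sumℤ xs ℤ.+ sumℤ ys
sumℤ-++ []       ys = ≡.sym (ℤ.+-identityˡ _)
sumℤ-++ (x ∷ xs) ys = ≡.trans (≡.cong (ℤ._+_ x) (sumℤ-++ xs ys)) (≡.sym (ℤ.+-assoc x _ _))

sumℤ-cartesian : ∀ {A B C : Set} (h : C → ℤ) (c : A → B → C) u N ys →
  sumℤ (map h (cartesianProductWith c (applyUpTo u N) ys))
    ≡ sumℤ (applyUpTo (λ i → sumℤ (map (λ y → h (c (u i) y)) ys)) N)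
sumℤ-cartesian h c u zero    ys = ≡.refl
sumℤ-cartesian h c u (suc N) ys = ≡.trans
  (≡.cong sumℤ (List.map-++ h (map (c (u 0)) ys) _))
  (≡.trans (sumℤ-++ (map h (map (c (u 0)) ys)) _)
    (≡.cong₂ ℤ._+_ (≡.cong sumℤ (≡.sym (List.map-∘ ys))) (sumℤ-cartesian h c (u ∘ suc) N ys)))

restrict-⊛ : ∀ k f g → let open Restricted k in
  restrict k (f ⊛ g) ≈ restrict k f * restrict k g
restrict-⊛ zero    f g   = ℤ.+-identityʳ _
restrict-⊛ (suc k) f g n = trans
  (restrict-cong k λ α _ → sumℤ-cartesian (λ (β , γ) → f β ℤ.* g γ)
    (λ (i , j) (β , γ) → i ∷ β , j ∷ γ) (λ i → i , n ∸ i) (suc n) (factorisations α))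
  (convolution n (λ i α → f (i ∷ α)) (λ i α → g (i ∷ α)))
  where
  open Restricted k hiding (zero)
  open PowerSeries (seriesSemiring k)
  convolution : ∀ n (f g : ℕ → Series) →
    restrict k (λ α → sumℤ (applyUpTo (λ i → (f i ⊛ g (n ∸ i)) α) (suc n)))
      ≈ ((λ i → restrict k (f i)) ⊗ (λ i → restrict k (g i))) n
  convolution zero    f g = trans (restrict-cong k λ α _ → ℤ.+-identityʳ _) (restrict-⊛ k (f 0) (g 0))
  convolution (suc n) f g = trans (restrict-+ k (f 0 ⊛ g (suc n)) _)
    (+-cong (restrict-⊛ k (f 0) (g (suc n))) (convolution n (f ∘ suc) g))

module _ (k : ℕ) where
  open Restricted k hiding (zero)
  open import Algebra.Properties.Semiring.Mult semiring using () renaming (_×_ to _·_)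

  restrict-scale : ∀ n f → restrict k (λ α → + n ℤ.* f α) ≈ n · restrict k f
  restrict-scale zero    f = restrict-0 k
  restrict-scale (suc n) f = trans (restrict-cong k λ α _ → ℤ.suc-* (+ n) (f α))
    (trans (restrict-+ k f (λ α → + n ℤ.* f α)) (+-congˡ (restrict-scale n f)))

-- Algebraic independence

series-+-cancelʳ : ∀ k → let open Restricted k in RightCancellative _≈_ _+_
series-+-cancelʳ zero    z x y eq   = Ring.+-cancelʳ ℤ.+-*-ring z x y eq
series-+-cancelʳ (suc k) z x y eq n = series-+-cancelʳ k (z n) (x n) (y n) (eq n)

module ListSum (A : CommutativeMonoid 0ℓ 0ℓ) where
  open CommutativeMonoid A

  ∑ₗ : ∀ {X : Set} → (X → Carrier) → List X → Carrier
  ∑ₗ g = foldr (λ l y → g l ∙ y) ε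

  ∑ₗ-cong : ∀ {X : Set} {g h : X → Carrier} L → All (λ l → g l ≈ h l) L → ∑ₗ g L ≈ ∑ₗ h L
  ∑ₗ-cong []      []       = refl
  ∑ₗ-cong (l ∷ L) (p ∷ ps) = ∙-cong p (∑ₗ-cong L ps)

  ∑ₗ-++ : ∀ {X : Set} (g : X → Carrier) L M → ∑ₗ g (L ++ M) ≈ ∑ₗ g L ∙ ∑ₗ g M
  ∑ₗ-++ g []      M = sym (identityˡ _)
  ∑ₗ-++ g (l ∷ L) M = trans (∙-congˡ (∑ₗ-++ g L M)) (sym (assoc _ _ _))

  -- Commutative monomials are kept as plain lists, not as a quotient; instead, only functions that
  -- ignore the order are summed over them.
  Symmetric : (List ℕ → Carrier) → Set
  Symmetric g = ∀ {l m} → l ↭ m → g l ≈ g m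

-- A sum of monomials in e₁, e₂, …; the entry i of a monomial stands for e_{i+1}.
Formal : Set
Formal = List (List ℕ)

infixl 7 _⊠_
_⊠_ : Formal → Formal → Formal
_⊠_ = cartesianProductWith _++_

module Evaluation (S : CommutativeSemiring 0ℓ 0ℓ) (e : ℕ → CommutativeSemiring.Carrier S) where
  open CommutativeSemiring S hiding (zero)
  open ListSum +-commutativeMonoid public

  term : List ℕ → Carrier
  term = foldr (λ i y → e i * y) 1#

  eval : Formal → Carrier
  eval = ∑ₗ term

  term-↭ : Symmetric term
  term-↭ Perm.refl          = refl
  term-↭ (Perm.prep i p)         = *-congˡ (term-↭ p)
  term-↭ (Perm.swap {xs} i j p)  =
    trans (*-congˡ (*-congˡ (term-↭ p))) (CommutativeSemigroup.x∙yz≈y∙xz *-commutativeSemigroup _ _ _)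
  term-↭ (Perm.trans p q)   = trans (term-↭ p) (term-↭ q)

  term-++ : ∀ l m → term (l ++ m) ≈ term l * term m
  term-++ []      m = sym (*-identityˡ _)
  term-++ (i ∷ l) m = trans (*-congˡ (term-++ l m)) (sym (*-assoc _ _ _))

  eval-cons : ∀ i L → ∑ₗ (λ l → term (i ∷ l)) L ≈ e i * eval L
  eval-cons i []      = sym (zeroʳ _)
  eval-cons i (l ∷ L) = trans (+-congˡ (eval-cons i L)) (sym (distribˡ _ _ _))

-- Here within holds the monomials divisible by e_{k+1}, with one such factor removed.
record Split (k N : ℕ) (L : Formal) : Set₁ where
  field
    without within : Formal
    without-< : All (All (_< k)) without
    within-<  : All (All (_< suc k)) within
    within-short : All (λ l → length l < N) within
    -- The generality in A and g serves two purposes: the given equality is split in the series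
    -- ring, the desired one in the target monoid.
    ∑-split : (A : CommutativeMonoid 0ℓ 0ℓ) → let open CommutativeMonoid A; open ListSum A in
      ∀ g → Symmetric g → ∑ₗ g L ≈ ∑ₗ g without ∙ ∑ₗ (λ l → g (k ∷ l)) within

extract : ∀ k l → All (_< suc k) l →
  All (_< k) l ⊎ Σ[ m ∈ List ℕ ] l ↭ k ∷ m × All (_< suc k) m × length l ≡ suc (length m)
extract k []      []       = inj₁ []
extract k (i ∷ l) (p ∷ ps) with i ℕ.≟ k | extract k l ps
... | yes ≡.refl | _ = inj₂ (l , ↭-refl , ps , ≡.refl)
... | no i≢k | inj₁ l<k = inj₁ (ℕ.≤∧≢⇒< (ℕ.s≤s⁻¹ p) i≢k ∷ l<k)
... | no i≢k | inj₂ (m , l↭ , m< , eq) =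
  inj₂ (i ∷ m , ↭-trans (Perm.prep i l↭) (Perm.swap i k ↭-refl) , p ∷ m< , ≡.cong suc eq)

split : ∀ k N L → All (All (_< suc k)) L → All (λ l → length l < suc N) L → Split k N L
split k N []      []       []       = record
  { without = [] ; within = [] ; without-< = [] ; within-< = [] ; within-short = []
  ; ∑-split = λ A g g-sym → CommutativeMonoid.sym A (CommutativeMonoid.identityˡ A _) }
split k N (l ∷ L) (p ∷ ps) (q ∷ qs) with extract k l p | split k N L ps qs
... | inj₁ l<k | s = record
  { without = l ∷ without ; within = within ; without-< = l<k ∷ without-<
  ; within-< = within-< ; within-short = within-short
  ; ∑-split = λ A g g-sym → let open CommutativeMonoid A in
      trans (∙-congˡ (∑-split A g g-sym)) (sym (assoc _ _ _)) }
  where open Split s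
... | inj₂ (m , l↭ , m< , eq) | s = record
  { without = without ; within = m ∷ within ; without-< = without-<
  ; within-< = m< ∷ within-< ; within-short = ℕ.s≤s⁻¹ (≡.subst (_< suc N) eq q) ∷ within-short
  ; ∑-split = λ A g g-sym → let open CommutativeMonoid A in
      trans (∙-cong (g-sym l↭) (∑-split A g g-sym))
        (CommutativeSemigroup.x∙yz≈y∙xz commutativeSemigroup _ _ _) }
  where open Split s

evalIn : ∀ k → Formal → Restricted.Carrier k
evalIn k = Evaluation.eval (seriesSemiring k) (λ i → elemOf k (suc i))

module _ (k : ℕ) where
  open Restricted k hiding (zero)

  ∑ₗ-at-0 : ∀ {X : Set} (g : X → Restricted.Carrier (suc k)) L →
    ListSum.∑ₗ (Restricted.+-commutativeMonoid (suc k)) g L 0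
      ≈ ListSum.∑ₗ +-commutativeMonoid (λ l → g l 0) L
  ∑ₗ-at-0 g []      = refl
  ∑ₗ-at-0 g (l ∷ L) = +-congˡ (∑ₗ-at-0 g L)

  term-at-0 : ∀ l → Evaluation.term (seriesSemiring (suc k)) (λ i → elemOf (suc k) (suc i)) l 0
    ≈ Evaluation.term (seriesSemiring k) (λ i → elemOf k (suc i)) l
  term-at-0 []      = refl
  term-at-0 (i ∷ l) = *-cong (elemOf-at-0 k (suc i)) (term-at-0 l)

  evalIn-at-0 : ∀ L → evalIn (suc k) L 0 ≈ evalIn k L
  evalIn-at-0 L = trans (∑ₗ-at-0 _ L)
    (ListSum.∑ₗ-cong +-commutativeMonoid L (All.universal term-at-0 L))

-- Setting x_k = 0 removes the monomials divisible by e_{k+1}; the two remainders then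
-- also agree in k + 1 variables, and what is left can be divided by e_{k+1}.
independence : ∀ k N L M →
  All (All (_< k)) L → All (All (_< k)) M →
  All (λ l → length l < N) L → All (λ l → length l < N) M →
  Restricted._≈_ k (evalIn k L) (evalIn k M) →
  (A : CommutativeMonoid 0ℓ 0ℓ) (g : List ℕ → CommutativeMonoid.Carrier A) → ListSum.Symmetric A g →
  CommutativeMonoid._≈_ A (ListSum.∑ₗ A g L) (ListSum.∑ₗ A g M)
-- Without variables every monomial is empty, so a formal sum amounts to its number of terms, which
-- its value in ℤ determines.
independence zero N L M L< M< _ _ eq A g g-sym =
  trans (copies L L<) (trans
    (reflexive (≡.cong (_· g []) (ℤ.+-injective (≡.trans (≡.sym (value L L<)) (≡.trans eq (value M M<))))))
    (sym (copies M M<)))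
  where
  open CommutativeMonoid A
  open ListSum A
  open import Algebra.Properties.CommutativeMonoid.Mult A using () renaming (_×_ to _·_)

  copies : ∀ L → All (All (_< 0)) L → ∑ₗ g L ≈ length L · g []
  copies []       []        = refl
  copies ([] ∷ L) ([] ∷ ps) = ∙-congˡ (copies L ps)

  value : ∀ L → All (All (_< 0)) L → evalIn 0 L ≡ ℤ.+ length L
  value []       []        = ≡.refl
  value ([] ∷ L) ([] ∷ ps) = ≡.cong (ℤ._+_ ℤ.1ℤ) (value L ps)
independence (suc k) zero []      []      _ _ _        _        eq A g g-sym = CommutativeMonoid.refl A
independence (suc k) zero []      (_ ∷ _) _ _ _        (() ∷ _) eq A g g-sym
independence (suc k) zero (_ ∷ _) M       _ _ (() ∷ _) _        eq A g g-sym
-- The descent is lexicographic: the quotients keep the number of variables but have shorter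
-- monomials, while the remainders lose a variable and may therefore take a new length bound.
independence (suc k) (suc N) L M L< M< L-short M-short eq A g g-sym =
  trans (S.∑-split A g g-sym) (trans
    (∙-cong (remainders A g g-sym)
      (independence (suc k) N S.within T.within S.within-< T.within-< S.within-short T.within-short
        quotients A (λ l → g (k ∷ l)) (λ p → g-sym (Perm.prep k p))))
    (sym (T.∑-split A g g-sym)))
  where
  open CommutativeMonoid A
  module S = Split (split k N L L< L-short)
  module T = Split (split k N M M< M-short)
  module R′ = Restricted (suc k)
  module R = Restricted k
  open Evaluation (seriesSemiring (suc k)) (λ i → elemOf (suc k) (suc i)) using (term; eval-cons; term-↭)
  top = elemOf (suc k) (suc k)

  divided : ∀ {L} (s : Split k N L) → evalIn (suc k) L
    R′.≈ evalIn (suc k) (Split.without s) R′.+ top R′.* evalIn (suc k) (Split.within s)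
  divided s = R′.trans (Split.∑-split s R′.+-commutativeMonoid term term-↭)
    (R′.+-congˡ {evalIn (suc k) (Split.without s)} (eval-cons k (Split.within s)))

  divided-at-0 : ∀ {L} (s : Split k N L) → evalIn (suc k) L 0 R.≈ evalIn k (Split.without s)
  divided-at-0 s = R.trans (divided s 0) (R.trans
    (R.+-cong (evalIn-at-0 k (Split.without s))
      (R.trans (R.*-congʳ (R.trans (elemOf-at-0 k (suc k))
        (elem->-0 (seriesSemiring k) (variableOf k) (suc k) ℕ.≤-refl))) (R.zeroˡ _)))
    (R.+-identityʳ _))

  remainders : (A : CommutativeMonoid 0ℓ 0ℓ) (g : List ℕ → CommutativeMonoid.Carrier A) → ListSum.Symmetric A g →
    CommutativeMonoid._≈_ A (ListSum.∑ₗ A g S.without) (ListSum.∑ₗ A g T.without)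
  remainders = independence k bound S.without T.without S.without-< T.without-<
    (short S.without bound-S) (short T.without bound-T)
    (R.trans (R.sym (divided-at-0 (split k N L L< L-short))) (R.trans (eq 0) (divided-at-0 (split k N M M< M-short))))
    where
    maximum = foldr (λ l m → suc (length l) ℕ.⊔ m) 0
    bound = maximum S.without ℕ.⊔ maximum T.without
    bound-S = ℕ.m≤m⊔n (maximum S.without) (maximum T.without)
    bound-T = ℕ.m≤n⊔m (maximum S.without) (maximum T.without)
    short : ∀ L {b} → maximum L ≤ b → All (λ l → length l < b) L
    short []      _  = []
    short (l ∷ L) le = ℕ.m⊔n≤o⇒m≤o (suc (length l)) (maximum L) le ∷ short L (ℕ.m⊔n≤o⇒n≤o (suc (length l)) (maximum L) le)

  quotients : evalIn (suc k) S.within R′.≈ evalIn (suc k) T.within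
  quotients = elemOf-top-cancel (suc k) (evalIn (suc k) S.within) (evalIn (suc k) T.within)
    (cancelˡ (R′.trans (R′.sym (divided (split k N L L< L-short))) (R′.trans eq
      (R′.trans (divided (split k N M M< M-short))
        (R′.+-congʳ {top R′.* evalIn (suc k) T.within} (R′.sym (remainders R′.+-commutativeMonoid term term-↭)))))))
    where
    cancelˡ : ∀ {a b c} → a R′.+ b R′.≈ a R′.+ c → b R′.≈ c
    cancelˡ {a} {b} {c} p = series-+-cancelʳ (suc k) a b c
      (R′.trans (R′.+-comm b a) (R′.trans p (R′.+-comm a c)))

-- Paths and spiders in terms of the elementary symmetric functions

module EvaluationProperties (S : CommutativeSemiring 0ℓ 0ℓ) (e : ℕ → CommutativeSemiring.Carrier S) where
  open CommutativeSemiring S hiding (zero)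
  open Evaluation S e
  open import Algebra.Properties.Semiring.Mult semiring using () renaming (_×_ to _·_)

  eval-map-++ : ∀ l M → eval (map (l ++_) M) ≈ term l * eval M
  eval-map-++ l []      = sym (zeroʳ _)
  eval-map-++ l (m ∷ M) = trans (+-cong (term-++ l m) (eval-map-++ l M)) (sym (distribˡ _ _ _))

  eval-⊠ : ∀ L M → eval (L ⊠ M) ≈ eval L * eval M
  eval-⊠ []      M = sym (zeroˡ _)
  eval-⊠ (l ∷ L) M = trans (∑ₗ-++ term (map (l ++_) M) (L ⊠ M))
    (trans (+-cong (eval-map-++ l M) (eval-⊠ L M)) (sym (distribʳ _ _ _)))

  eval-replicate : ∀ n l → eval (replicate n l) ≈ n · term l
  eval-replicate zero    l = refl
  eval-replicate (suc n) l = +-congˡ (eval-replicate n l)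

-- The values pathFormal n, …, pathFormal 0.
history : ℕ → ℕ → Formal
convolve : (ℕ → Formal) → (ℕ → Formal) → ℕ → Formal

history zero    i       = [] ∷ []
-- The repetition encodes the coefficient in i e_{i+1}, and entry i of `history n` is the formal sum
-- for the path with n - i vertices.
history (suc n) zero    = (n ∷ []) ∷ convolve (λ i → replicate i (i ∷ [])) (history n) n
history (suc n) (suc i) = history n i

convolve w h zero    = w 0 ⊠ h 0
convolve w h (suc n) = w 0 ⊠ h 0 ++ convolve (w ∘ suc) (h ∘ suc) n

pathFormal : ℕ → Formal
pathFormal n = history n 0

module PathRecursion (S : CommutativeSemiring 0ℓ 0ℓ) (e : ℕ → CommutativeSemiring.Carrier S) where
  open CommutativeSemiring S hiding (zero)
  open Evaluation S e
  open EvaluationProperties S e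
  open PowerSeries S using (PS; tail; _⊗_; ⊗-cong)
  open import Algebra.Properties.Semiring.Mult semiring using (×-congʳ) renaming (_×_ to _·_)

  -- This is P (E - z E′) = E read at the power n + 1 of z, with `e i` standing for e_{i+1}: the
  -- coefficient of E - z E′ at the power i + 1 is -i e_{i+1}, which changes sign when moved to the
  -- other side.
  Recursion : PS → Set
  Recursion p = p 0 ≈ 1# × (∀ n → p (suc n) ≈ e n + ((λ i → i · e i) ⊗ p) n)

  eval-convolve : ∀ w n → eval (convolve w (history n) n) ≈ ((eval ∘ w) ⊗ (eval ∘ pathFormal)) n
  eval-convolve w zero    = eval-⊠ (w 0) (history 0 0)
  eval-convolve w (suc n) = trans (∑ₗ-++ term (w 0 ⊠ history (suc n) 0) _)
    (+-cong (eval-⊠ (w 0) (history (suc n) 0)) (eval-convolve (w ∘ suc) n))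

  eval-pathFormal : Recursion (eval ∘ pathFormal)
  eval-pathFormal = +-identityʳ _ , λ n → +-cong (*-identityʳ _)
    (trans (eval-convolve (λ i → replicate i (i ∷ [])) n)
      (⊗-cong {g = eval ∘ pathFormal} (λ i → trans (eval-replicate i (i ∷ [])) (×-congʳ i (*-identityʳ _))) (λ _ → refl) n))

  ⊗-cong-≤ : ∀ f {p q} n → (∀ {m} → m ≤ n → p m ≈ q m) → (f ⊗ p) n ≈ (f ⊗ q) n
  ⊗-cong-≤ f zero    eq = *-congˡ (eq z≤n)
  ⊗-cong-≤ f (suc n) eq = +-cong (*-congˡ (eq ℕ.≤-refl)) (⊗-cong-≤ (tail f) n (λ m≤n → eq (ℕ.m≤n⇒m≤1+n m≤n)))

  recursion-unique : ∀ {p q} → Recursion p → Recursion q → ∀ n → p n ≈ q n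
  recursion-unique {p} {q} (p0 , psuc) (q0 , qsuc) n = go n ℕ.≤-refl
    where
    go : ∀ n {m} → m ≤ n → p m ≈ q m
    go n       {zero}  _         = trans p0 (sym q0)
    go (suc n) {suc m} (s≤s m≤n) = trans (psuc m) (trans
      (+-congˡ (⊗-cong-≤ (λ i → i · e i) m λ l≤m → go n (ℕ.≤-trans l≤m m≤n))) (sym (qsuc m)))

evalIn-pathFormal : ∀ k n → let open Restricted k in
  Words.path (seriesSemiring k) (variableOf k) n ≈ evalIn k (pathFormal n)
evalIn-pathFormal k = recursion-unique
  (refl , Elementary.path-suc (seriesSemiring k) (series-+-cancelʳ k) (variableOf k)) eval-pathFormal
  where
  open Restricted k hiding (zero)
  open PathRecursion (seriesSemiring k) (λ i → elemOf k (suc i))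

module _ (k : ℕ) where
  open Restricted k hiding (zero)
  open Evaluation (seriesSemiring k) (λ i → elemOf k (suc i))

  restrict-elementaryOf : ∀ μ → All (0 <_) μ → restrict k (elementaryOf μ) ≈ term (map pred μ)
  restrict-elementaryOf []          _        = restrict-elementary k 0
  restrict-elementaryOf (suc i ∷ μ) (_ ∷ ps) = trans (restrict-⊛ k (elementary (suc i)) (elementaryOf μ))
    (*-cong (restrict-elementary k (suc i)) (restrict-elementaryOf μ ps))

-- From a nonnegative e-expansion to an identity of formal sums

module Expansion {f : Series} (E : EExpansion f)
  (nonneg : All (λ μ → 0ℤ ℤ.≤ EExpansion.coeff E μ) (EExpansion.support E)) where
  open EExpansion E

  -- Here e-positivity enters: a nonnegative coefficient can be expressed by repeating its monomial.
  -- The parts are lowered by one because entry i stands for e_{i+1}.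
  formal : Formal
  formal = concatMap (λ μ → replicate ∣ coeff μ ∣ (map pred μ)) support

  module _ (k : ℕ) where
    open Restricted k hiding (zero)
    open Evaluation (seriesSemiring k) (λ i → elemOf k (suc i))
    open EvaluationProperties (seriesSemiring k) (λ i → elemOf k (suc i))
    open import Algebra.Properties.Semiring.Mult semiring using (×-congʳ)

    restrict-support : ∀ ms → All (λ μ → 0ℤ ℤ.≤ coeff μ) ms → All IsPartition ms →
      restrict k (λ α → sumℤ (map (λ μ → coeff μ ℤ.* elementaryOf μ α) ms))
        ≈ eval (concatMap (λ μ → replicate ∣ coeff μ ∣ (map pred μ)) ms)
    restrict-support []       []       []             = restrict-0 k
    restrict-support (μ ∷ ms) (p ∷ ps) ((_ , q) ∷ qs) = trans
      (restrict-+ k (λ α → coeff μ ℤ.* elementaryOf μ α) _) (trans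
        (+-cong (trans (restrict-cong k λ α _ → ≡.cong (ℤ._* elementaryOf μ α) (≡.sym (ℤ.0≤i⇒+∣i∣≡i p)))
          (trans (restrict-scale k ∣ coeff μ ∣ (elementaryOf μ))
            (trans (×-congʳ ∣ coeff μ ∣ (restrict-elementaryOf k μ q)) (sym (eval-replicate ∣ coeff μ ∣ (map pred μ))))))
          (restrict-support ms ps qs))
        (sym (∑ₗ-++ term (replicate ∣ coeff μ ∣ (map pred μ)) _)))

    restrict-formal : restrict k f ≈ evalIn k formal
    restrict-formal = trans (restrict-cong k λ α _ → expansion α) (restrict-support support nonneg partitions)

bounded : ∀ L → ∃[ k ] (∀ {n} → k ≤ n → All (All (_< n)) L)
bounded []      = 0 , λ _ → []
bounded (l ∷ L) with row l | bounded L
  where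
  row : ∀ l → ∃[ k ] (∀ {n} → k ≤ n → All (_< n) l)
  row []      = 0 , λ _ → []
  row (i ∷ l) with row l
  ... | k , p = suc i ℕ.⊔ k , λ le → ℕ.m⊔n≤o⇒m≤o (suc i) k le ∷ p (ℕ.m⊔n≤o⇒n≤o (suc i) k le)
... | k , p | k′ , q = k ℕ.⊔ k′ , λ le → p (ℕ.m⊔n≤o⇒m≤o k k′ le) ∷ q (ℕ.m⊔n≤o⇒n≤o k k′ le)

short : ∀ (L : Formal) → ∃[ k ] (∀ {n} → k ≤ n → All (λ l → length l < n) L)
short []      = 0 , λ _ → []
short (l ∷ L) with short L
... | k , p = suc (length l) ℕ.⊔ k , λ le → ℕ.m⊔n≤o⇒m≤o (suc (length l)) k le ∷ p (ℕ.m⊔n≤o⇒n≤o (suc (length l)) k le)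

-- Only finitely many eᵢ occur in the two sums, so a large enough number of variables keeps all of
-- them independent.
specialise : ∀ L M → (∀ k → Restricted._≈_ k (evalIn k L) (evalIn k M)) →
  (S : CommutativeSemiring 0ℓ 0ℓ) (e : ℕ → CommutativeSemiring.Carrier S) →
  CommutativeSemiring._≈_ S (Evaluation.eval S e L) (Evaluation.eval S e M)
specialise L M eq S e = independence k n L M
  (proj₂ (bounded L) (ℕ.m≤m⊔n _ _)) (proj₂ (bounded M) (ℕ.m≤n⊔m (proj₁ (bounded L)) _))
  (proj₂ (short L) (ℕ.m≤m⊔n _ _)) (proj₂ (short M) (ℕ.m≤n⊔m (proj₁ (short L)) _))
  (eq k) (CommutativeSemiring.+-commutativeMonoid S) term term-↭
  where
  open Evaluation S e
  k = proj₁ (bounded L) ℕ.⊔ proj₁ (bounded M)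
  n = proj₁ (short L) ℕ.⊔ proj₁ (short M)

module _ (a b : ℕ) (positive : EPositiveGraph (spider (a ∷ b ∷ 1 ∷ []))) where
  private
    open Expansion (proj₁ positive) (proj₂ positive)
    L = formal ++ pathFormal (suc a) ⊠ pathFormal (suc b)
    M = pathFormal (suc (suc (a ℕ.+ b))) ++ pathFormal 1 ⊠ pathFormal (suc (a ℕ.+ b))

  evalIn-spider : ∀ k → Restricted._≈_ k (evalIn k L) (evalIn k M)
  evalIn-spider k = begin
    evalIn k L
      ≈⟨ ∑ₗ-++ term formal _ ⟩
    evalIn k formal + evalIn k (pathFormal (suc a) ⊠ pathFormal (suc b))
      ≈⟨ +-cong (trans (sym (restrict-formal k)) (restrict-chromatic (a ∷ b ∷ 1 ∷ []))) (path-⊠ (suc a) (suc b)) ⟩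
    ∑ (λ c → variableOf k c * legs (a ∷ b ∷ 1 ∷ []) c) + path (suc a) * path (suc b)
      ≈⟨ Elementary.spider-path (seriesSemiring k) (series-+-cancelʳ k) (variableOf k) a b ⟩
    path (suc (suc (a ℕ.+ b))) + path 1 * path (suc (a ℕ.+ b))
      ≈⟨ +-cong (evalIn-pathFormal k (suc (suc (a ℕ.+ b)))) (sym (path-⊠ 1 (suc (a ℕ.+ b)))) ⟩
    evalIn k (pathFormal (suc (suc (a ℕ.+ b)))) + evalIn k (pathFormal 1 ⊠ pathFormal (suc (a ℕ.+ b)))
      ≈⟨ ∑ₗ-++ term (pathFormal (suc (suc (a ℕ.+ b)))) _ ⟨
    evalIn k M ∎
    where
    open Restricted k hiding (zero)
    open Evaluation (seriesSemiring k) (λ i → elemOf k (suc i))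
    open EvaluationProperties (seriesSemiring k) (λ i → elemOf k (suc i))
    open Words (seriesSemiring k) (variableOf k) using (path; legs)
    open Chromatic k using (restrict-chromatic)
    open import Algebra.Properties.Semiring.Sum semiring using () renaming (sum to ∑)
    open SetoidReasoning setoid

    path-⊠ : ∀ m n → evalIn k (pathFormal m ⊠ pathFormal n) ≈ path m * path n
    path-⊠ m n = trans (eval-⊠ (pathFormal m) (pathFormal n))
      (sym (*-cong (evalIn-pathFormal k m) (evalIn-pathFormal k n)))

  module _ (S : CommutativeSemiring 0ℓ 0ℓ) (e : ℕ → CommutativeSemiring.Carrier S) where
    open CommutativeSemiring S hiding (zero)
    open Evaluation S e
    open EvaluationProperties S e

    -- The witness is the value of the spider's own expansion. When all elements of the semiring are
    -- nonnegative, its existence is an inequality.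
    spider-relation : ∃[ x ] x + eval (pathFormal (suc a)) * eval (pathFormal (suc b))
      ≈ eval (pathFormal (suc (suc (a ℕ.+ b)))) + e 0 * eval (pathFormal (suc (a ℕ.+ b)))
    spider-relation = eval formal , trans
      (sym (trans (∑ₗ-++ term formal _) (+-congˡ (eval-⊠ (pathFormal (suc a)) (pathFormal (suc b))))))
      (trans (specialise L M evalIn-spider S e)
        (trans (∑ₗ-++ term (pathFormal (suc (suc (a ℕ.+ b)))) _)
          (+-congˡ (trans (eval-⊠ (pathFormal 1) (pathFormal (suc (a ℕ.+ b))))
            (*-congʳ (trans (+-identityʳ _) (*-identityʳ _)))))))

-- Specialisations into ℕ[[ε]]

open import Data.Nat.Base using (_+_; _*_)

module ℕSeries = PowerSeries ℕ.+-*-commutativeSemiring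
open ℕSeries using (_⊗_; ⊗-cong; ⊗-scale; ⊗-zeroˡ; constant-⊗)
module TSeries = PowerSeries ℕSeries.powerSeries

T : CommutativeSemiring 0ℓ 0ℓ
T = ℕSeries.powerSeries

δ : ℕ → ℕ → ℕ
δ m i = if m ≡ᵇ i then 1 else 0

-- The index is written as a sum because the recursion below produces d plus a multiple of d + 1,
-- and the multiple may be zero.
δ-diagonal : ∀ m → δ m (m + 0) ≡ 1
δ-diagonal zero    = ≡.refl
δ-diagonal (suc m) = δ-diagonal m

δ-off : ∀ m n → δ m (m + suc n) ≡ 0
δ-off zero    n = ≡.refl
δ-off (suc m) n = δ-off m n

δ-< : ∀ {m n} → n < m → δ m n ≡ 0
δ-< {suc m} {zero}  _         = ≡.refl
δ-< {suc m} {suc n} (s≤s n<m) = δ-< n<m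

*-δ : ∀ m i → i * δ m i ≡ m * δ m i
*-δ zero    zero    = ≡.refl
*-δ zero    (suc i) = ℕ.*-zeroʳ i
*-δ (suc m) zero    = ≡.sym (ℕ.*-zeroʳ m)
*-δ (suc m) (suc i) = ≡.cong (_+_ (δ m i)) (*-δ m i)

δ-⊗ : ∀ m f n → (δ m ⊗ f) (m + n) ≡ f n
δ-⊗ zero    f zero    = ℕ.*-identityˡ _
δ-⊗ zero    f (suc n) = ≡.trans (≡.cong₂ _+_ (ℕ.*-identityˡ _) (⊗-zeroˡ f n)) (ℕ.+-identityʳ _)
δ-⊗ (suc m) f n       = δ-⊗ m f n

δ-⊗-< : ∀ {m n} f → n < m → (δ m ⊗ f) n ≡ 0
δ-⊗-< {suc m} {zero}  f _         = ≡.refl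
δ-⊗-< {suc m} {suc n} f (s≤s n<m) = δ-⊗-< f n<m

weighted-δ-⊗ : ∀ m f n → ((λ i → i * δ m i) ⊗ f) n ≡ m * (δ m ⊗ f) n
weighted-δ-⊗ m f n = ≡.trans (⊗-cong {g = f} (*-δ m) (λ _ → ≡.refl) n) (⊗-scale m (δ m) f n)

⊗-coefficient-0 : ∀ w q n → (w TSeries.⊗ q) n 0 ≡ ((λ i → w i 0) ⊗ (λ i → q i 0)) n
⊗-coefficient-0 w q zero    = ≡.refl
⊗-coefficient-0 w q (suc n) = ≡.cong (_+_ (w 0 0 * q (suc n) 0)) (⊗-coefficient-0 (w ∘ suc) q n)

-- The weights have degree at most one in ε, so only two terms of each product in ε survive.
⊗-coefficient-suc : ∀ w q → (∀ i j → w i (suc (suc j)) ≡ 0) → ∀ j n → (w TSeries.⊗ q) n (suc j)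
  ≡ ((λ i → w i 0) ⊗ (λ i → q i (suc j))) n + ((λ i → w i 1) ⊗ (λ i → q i j)) n
⊗-coefficient-suc w q linear j = go w linear
  where
  product : ∀ w y → (∀ j → w (suc (suc j)) ≡ 0) → (w ⊗ y) (suc j) ≡ w 0 * y (suc j) + w 1 * y j
  product w y linear = ≡.cong (_+_ (w 0 * y (suc j))) (≡.trans
    (⊗-cong {g = y} {g′ = y} (λ { zero → ≡.refl ; (suc i) → linear i }) (λ _ → ≡.refl) j)
    (constant-⊗ (w 1) y j))

  regroup : ∀ a b c d → (a + b) + (c + d) ≡ (a + c) + (b + d)
  regroup = solve-∀

  go : ∀ w → (∀ i j → w i (suc (suc j)) ≡ 0) → ∀ n → (w TSeries.⊗ q) n (suc j)
    ≡ ((λ i → w i 0) ⊗ (λ i → q i (suc j))) n + ((λ i → w i 1) ⊗ (λ i → q i j)) n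
  go w linear zero    = product (w 0) (q 0) (linear 0)
  go w linear (suc n) = ≡.trans
    (≡.cong₂ _+_ (product (w 0) (q (suc n)) (linear 0)) (go (w ∘ suc) (linear ∘ suc) n))
    (regroup (w 0 0 * q (suc n) (suc j)) _ _ _)

-- A record, since unification would otherwise unfold the graph.
record Positive (a b : ℕ) : Set where
  constructor positive
  field
    ePositive : EPositiveGraph (spider (a ∷ b ∷ 1 ∷ []))

-- The specialisation e_{d+1} = 1, e_{r+1} = ε, with all other e_i zero, into ℕ[[ε]].
module Specialisation (d r : ℕ) (0<d : 0 < d) (0<r : 0 < r) where

  e : ℕ → ℕ → ℕ
  e i zero          = δ d i
  e i (suc zero)    = δ r i
  e i (suc (suc j)) = 0

  private
    module R = PathRecursion T e
    open import Algebra.Properties.Semiring.Mult (CommutativeSemiring.semiring T) using () renaming (_×_ to _·_)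

    ·-coefficient : ∀ n (f : ℕ → ℕ) j → (n · f) j ≡ n * f j
    ·-coefficient zero    f j = ≡.refl
    ·-coefficient (suc n) f j = ≡.cong (_+_ (f j)) (·-coefficient n f j)

  abstract
    -- Kept opaque: all that follows rests on the recursion and on the relation for the spider.
    q : ℕ → ℕ → ℕ
    q n = Evaluation.eval T e (pathFormal n)

    q-recursion : R.Recursion q
    q-recursion = R.eval-pathFormal

    q-relation : ∀ {a b} → Positive a b →
      Σ[ x ∈ (ℕ → ℕ) ] (∀ j → x j + (q (suc a) ⊗ q (suc b)) j ≡ q (suc (suc (a + b))) j + (e 0 ⊗ q (suc (a + b))) j)
    q-relation {a} {b} (positive p) = spider-relation a b p T e

  coefficient-0 : ∀ n → q (suc n) 0 ≡ δ d n + d * (δ d ⊗ (λ i → q i 0)) n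
  coefficient-0 n = ≡.trans (proj₂ q-recursion n 0) (≡.cong (_+_ (δ d n))
    (≡.trans (⊗-coefficient-0 _ q n)
      (≡.trans (⊗-cong (λ i → ·-coefficient i (e i) 0) (λ _ → ≡.refl) n) (weighted-δ-⊗ d _ n))))

  coefficient-suc : ∀ n j → q (suc n) (suc j) ≡
    e n (suc j) + (d * (δ d ⊗ (λ i → q i (suc j))) n + r * (δ r ⊗ (λ i → q i j)) n)
  coefficient-suc n j = ≡.trans (proj₂ q-recursion n (suc j)) (≡.cong (_+_ (e n (suc j)))
    (≡.trans (⊗-coefficient-suc _ q (λ i k → ≡.trans (·-coefficient i (e i) (suc (suc k))) (ℕ.*-zeroʳ i)) j n)
      (≡.cong₂ _+_
        (≡.trans (⊗-cong (λ i → ·-coefficient i (e i) 0) (λ _ → ≡.refl) n) (weighted-δ-⊗ d _ n))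
        (≡.trans (⊗-cong (λ i → ·-coefficient i (e i) 1) (λ _ → ≡.refl) n) (weighted-δ-⊗ r _ n)))))

  product-≤ : ∀ {a b} → Positive a b →
    ∀ j → (q (suc a) ⊗ q (suc b)) j ≤ q (suc (suc (a + b))) j
  product-≤ {a} {b} p j = bound (q-relation p)
    where
    open ℕ.≤-Reasoning
    n = suc (a + b)

    -- Both distinguished indices d + 1 and r + 1 exceed 1, so e₁ takes the value zero.
    e₀ : ∀ j → e 0 j ≡ 0
    e₀ zero          = δ-< 0<d
    e₀ (suc zero)    = δ-< 0<r
    e₀ (suc (suc j)) = ≡.refl

    bound : Σ[ x ∈ (ℕ → ℕ) ] (∀ j → x j + (q (suc a) ⊗ q (suc b)) j ≡ q (suc n) j + (e 0 ⊗ q n) j) →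
      (q (suc a) ⊗ q (suc b)) j ≤ q (suc n) j
    bound (x , eq) = begin
      (q (suc a) ⊗ q (suc b)) j          ≤⟨ ℕ.m≤n+m _ (x j) ⟩
      x j + (q (suc a) ⊗ q (suc b)) j    ≡⟨ eq j ⟩
      q (suc n) j + (e 0 ⊗ q n) j        ≡⟨ ≡.cong (_+_ (q (suc n) j)) (⊗-cong {g = q n} e₀ (λ _ → ≡.refl) j) ⟩
      q (suc n) j + ((λ _ → 0) ⊗ q n) j  ≡⟨ ≡.cong (_+_ (q (suc n) j)) (⊗-zeroˡ (q n) j) ⟩
      q (suc n) j + 0                    ≡⟨ ℕ.+-identityʳ _ ⟩
      q (suc n) j                        ∎

  -- At ε = 0, with s = d + 1, the path series is (1 + z^s)/(1 - d z^s). Its coefficient at the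
  -- power (m + 1) s is d^(m+1) + d^m.
  coefficient-0-multiple : ∀ m → q (suc m * suc d) 0 ≡ suc d * d ^ m
  coefficient-0-multiple m = ≡.trans (coefficient-0 (d + m * suc d))
    (≡.trans (≡.cong (λ y → δ d (d + m * suc d) + d * y) (δ-⊗ d _ (m * suc d))) (step m))
    where
    step : ∀ m → δ d (d + m * suc d) + d * q (m * suc d) 0 ≡ suc d * d ^ m
    step zero    = ≡.trans (≡.cong₂ (λ x y → x + d * y) (δ-diagonal d) (proj₁ q-recursion 0)) (≡.sym (identity d))
      where
      identity : ∀ d → suc d * 1 ≡ 1 + d * 1
      identity = solve-∀
    step (suc m) = ≡.trans (≡.cong₂ (λ x y → x + d * y) (δ-off d (d + m * suc d)) (coefficient-0-multiple m))
      (identity d (d ^ m))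
      where
      identity : ∀ d y → 0 + d * (suc d * y) ≡ suc d * (d * y)
      identity = solve-∀

  coefficient-1-at-1 : q 1 1 ≡ 0
  coefficient-1-at-1 = ≡.trans (coefficient-suc 0 0)
    (≡.cong₂ _+_ (δ-< 0<r) (≡.cong₂ _+_ (≡.trans (≡.cong (d *_) (δ-⊗-< (λ i → q i 1) 0<d)) (ℕ.*-zeroʳ d))
      (≡.trans (≡.cong (r *_) (δ-⊗-< (λ i → q i 0) 0<r)) (ℕ.*-zeroʳ r))))

  module _ (r≢d : r ≢ d) (r≤1+d : r ≤ suc d) where

    -- With s = d + 1 and t = r + 1, the ε-part of the path series is z^t/(1 - d z^s) + r z^t (1 +
    -- z^s)/(1 - d z^s)². The double pole makes the coefficient linear in k up to a power of d; the
    -- factor d on the left avoids d^(k-1).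
    coefficient-1 : ∀ k → d * q (k * suc d + suc r) 1 ≡ d ^ k * (suc r * d + suc d * k * r)
    coefficient-1 zero = ≡.trans (≡.cong (d *_) (≡.trans (coefficient-suc r 0)
        (≡.cong₂ _+_ δ-r (≡.cong₂ _+_ (≡.trans (≡.cong (d *_) vanish) (ℕ.*-zeroʳ d)) (≡.cong (r *_) one)))))
      (identity d r)
      where
      identity : ∀ d r → d * (1 + (0 + r * 1)) ≡ 1 * (suc r * d + suc d * 0 * r)
      identity = solve-∀

      δ-r : δ r r ≡ 1
      δ-r = ≡.trans (≡.cong (δ r) (≡.sym (ℕ.+-identityʳ r))) (δ-diagonal r)

      one : (δ r ⊗ (λ i → q i 0)) r ≡ 1
      one = ≡.trans (≡.cong (δ r ⊗ _) (≡.sym (ℕ.+-identityʳ r)))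
        (≡.trans (δ-⊗ r _ 0) (proj₁ q-recursion 0))

      -- The convolution reads the ε-coefficient at index r - d, which is out of range for r < d and
      -- equals 1 for r = d + 1.
      vanish : (δ d ⊗ (λ i → q i 1)) r ≡ 0
      vanish with ℕ.<-cmp r d
      ... | tri< r<d _ _ = δ-⊗-< _ r<d
      ... | tri≈ _ r≡d _ = contradiction r≡d r≢d
      ... | tri> _ _ d<r = ≡.trans (≡.cong (δ d ⊗ _) (≡.trans (ℕ.≤-antisym r≤1+d d<r) (ℕ.+-comm 1 d)))
        (≡.trans (δ-⊗ d _ 1) coefficient-1-at-1)
    coefficient-1 (suc k) = ≡.trans (≡.cong (d *_) (≡.trans (coefficient-suc (d + k * suc d + suc r) 0)
        (≡.cong₂ _+_ (≡.trans (≡.cong (δ r) shift-r) (δ-off r (d + k * suc d)))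
          (≡.cong₂ _+_ (≡.cong (d *_)
            (≡.trans (≡.cong (δ d ⊗ _) (ℕ.+-assoc d (k * suc d) (suc r))) (δ-⊗ d _ (k * suc d + suc r))))
            (≡.cong (r *_) (≡.trans (≡.cong (δ r ⊗ _) shift-r)
              (≡.trans (δ-⊗ r _ (suc k * suc d)) (coefficient-0-multiple k))))))))
      (≡.trans (≡.cong (λ y → d * (0 + (y + r * (suc d * d ^ k)))) (coefficient-1 k)) (identity d r k (d ^ k)))
      where
      shift-r : d + k * suc d + suc r ≡ r + suc k * suc d
      shift-r = lemma d r k
        where
        lemma : ∀ d r k → d + k * suc d + suc r ≡ r + suc k * suc d
        lemma = solve-∀
      identity : ∀ d r k y → d * (0 + (y * (suc r * d + suc d * k * r) + r * (suc d * y)))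
        ≡ d * y * (suc r * d + suc d * suc k * r)
      identity = solve-∀

-- Bounds from the coefficients of ε⁰ and ε¹

module _ {a b : ℕ} (p : Positive a b) (d m : ℕ) (0<d : 0 < d)
  (b-eq : suc b ≡ suc m * suc d) where

  -- The product has (d + 1)² d^(k+m) at ε⁰, the longer path only (d + 1) d^(k+m+1); cancelling
  -- would leave d + 1 ≤ d.
  not-both-multiples : ∀ k → suc a ≢ suc k * suc d
  not-both-multiples k a-eq = ℕ.<-irrefl ≡.refl (ℕ.*-cancelʳ-≤ (suc d) d (suc d * (d ^ k * d ^ m)) (begin
    suc d * (suc d * (d ^ k * d ^ m))
      ≡⟨ regroup (suc d) (d ^ k) (d ^ m) ⟩
    suc d * d ^ k * (suc d * d ^ m)
      ≡⟨ ≡.cong₂ _*_ (coefficient-0-multiple k) (coefficient-0-multiple m) ⟨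
    q (suc k * suc d) 0 * q (suc m * suc d) 0
      ≡⟨ ≡.cong₂ (λ x y → q x 0 * q y 0) a-eq b-eq ⟨
    q (suc a) 0 * q (suc b) 0
      ≤⟨ product-≤ p 0 ⟩
    q (suc (suc (a + b))) 0
      ≡⟨ ≡.cong (λ x → q x 0) total ⟩
    q (suc (k + suc m) * suc d) 0
      ≡⟨ coefficient-0-multiple (k + suc m) ⟩
    suc d * d ^ (k + suc m)
      ≡⟨ ≡.cong (suc d *_) (ℕ.^-distribˡ-+-* d k (suc m)) ⟩
    suc d * (d ^ k * (d * d ^ m))
      ≡⟨ swap (suc d) d (d ^ k) (d ^ m) ⟩
    d * (suc d * (d ^ k * d ^ m)) ∎))
    where
    -- The comparison is made at ε⁰, so any positive second index may be chosen.
    open Specialisation d (suc d) 0<d (s≤s z≤n)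
    open ℕ.≤-Reasoning
    regroup : ∀ s x y → s * (s * (x * y)) ≡ s * x * (s * y)
    regroup = solve-∀
    swap : ∀ s d x y → s * (x * (d * y)) ≡ d * (s * (x * y))
    swap = solve-∀
    total : suc (suc (a + b)) ≡ suc (k + suc m) * suc d
    total = ≡.trans (≡.cong suc (≡.sym (ℕ.+-suc a b)))
      (≡.trans (≡.cong₂ _+_ a-eq b-eq) (≡.sym (ℕ.*-distribʳ-+ (suc d) (suc k) (suc m))))
    instance
      power : NonZero (suc d * (d ^ k * d ^ m))
      power = ℕ.m*n≢0 (suc d) (d ^ k * d ^ m) {{_}}
        {{ℕ.m*n≢0 _ _ {{ℕ.m^n≢0 d k {{>-nonZero 0<d}}}} {{ℕ.m^n≢0 d m {{>-nonZero 0<d}}}}}}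

  -- With X the left-hand side, the ε-coefficients give (d + 1) X ≤ d (X + (d + 1)(m + 1) r) after
  -- cancelling d^(k+m). The admissible values 2, ..., d and d + 2 of r + 1 represent each nonzero
  -- residue modulo d + 1 once; residue 1 is represented by d + 2, since e₁ has to vanish.
  remainder-bound : ∀ k r → 0 < r → r ≢ d → r ≤ suc d → suc a ≡ k * suc d + suc r →
    suc r * d + suc d * k * r ≤ suc d * d * suc m * r
  remainder-bound k r 0<r r≢d r≤1+d a-eq = ℕ.+-cancelʳ-≤ (d * X) X _ (ℕ.*-cancelʳ-≤ _ _ P (begin
    (X + d * X) * P
      ≡⟨ regroup d (d ^ k) (d ^ m) X ⟩
    d ^ k * X * (suc d * d ^ m)
      ≡⟨ ≡.cong₂ _*_ (coefficient-1 r≢d r≤1+d k) (coefficient-0-multiple m) ⟨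
    d * q (k * suc d + suc r) 1 * q (suc m * suc d) 0
      ≡⟨ ≡.cong₂ (λ x y → d * q x 1 * q y 0) a-eq b-eq ⟨
    d * q (suc a) 1 * q (suc b) 0
      ≡⟨ ℕ.*-assoc d _ _ ⟩
    d * (q (suc a) 1 * q (suc b) 0)
      -- Of the two terms of the product at ε¹, the one with the ε taken from `q (suc b)` is
      -- dropped.
      ≤⟨ ℕ.*-monoʳ-≤ d (ℕ.≤-trans (ℕ.m≤n+m _ (q (suc a) 0 * q (suc b) 1)) (product-≤ p 1)) ⟩
    d * q (suc (suc (a + b))) 1
      ≡⟨ ≡.cong (λ x → d * q x 1) total ⟩
    d * q ((k + suc m) * suc d + suc r) 1
      ≡⟨ coefficient-1 r≢d r≤1+d (k + suc m) ⟩
    d ^ (k + suc m) * (suc r * d + suc d * (k + suc m) * r)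
      ≡⟨ ≡.cong (_* (suc r * d + suc d * (k + suc m) * r)) (ℕ.^-distribˡ-+-* d k (suc m)) ⟩
    d ^ k * (d * d ^ m) * (suc r * d + suc d * (k + suc m) * r)
      ≡⟨ expand d k m r (d ^ k) (d ^ m) ⟩
    (suc d * d * suc m * r + d * X) * P ∎))
    where
    open Specialisation d r 0<d 0<r
    open ℕ.≤-Reasoning
    X = suc r * d + suc d * k * r
    P = d ^ k * d ^ m
    regroup : ∀ d x y X → (X + d * X) * (x * y) ≡ x * X * (suc d * y)
    regroup = solve-∀
    expand : ∀ d k m r x y → x * (d * y) * (suc r * d + suc d * (k + suc m) * r)
      ≡ (suc d * d * suc m * r + d * (suc r * d + suc d * k * r)) * (x * y)
    expand = solve-∀
    total : suc (suc (a + b)) ≡ (k + suc m) * suc d + suc r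
    total = ≡.trans (≡.cong suc (≡.sym (ℕ.+-suc a b)))
      (≡.trans (≡.cong₂ _+_ a-eq b-eq) (lemma d k m r))
      where
      lemma : ∀ d k m r → k * suc d + suc r + suc m * suc d ≡ (k + suc m) * suc d + suc r
      lemma = solve-∀
    instance
      power : NonZero P
      power = ℕ.m*n≢0 _ _ {{ℕ.m^n≢0 d k {{>-nonZero 0<d}}}} {{ℕ.m^n≢0 d m {{>-nonZero 0<d}}}}

-- The coefficient of ε² for e₂ = 1 and e₃ = ε

module Even where
  open Specialisation 1 2 (s≤s z≤n) (s≤s z≤n)

  coefficient-1-odd : ∀ k → q (k * 2 + 3) 1 ≡ 3 + 4 * k
  coefficient-1-odd k = ≡.trans (≡.sym (ℕ.*-identityˡ _))
    (≡.trans (coefficient-1 (λ ()) ℕ.≤-refl k) (≡.trans (≡.cong (_* (3 * 1 + 2 * k * 2)) (ℕ.^-zeroˡ k)) (identity k)))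
    where
    identity : ∀ k → 1 * (3 * 1 + 2 * k * 2) ≡ 3 + 4 * k
    identity = solve-∀

  -- A second factor e₃ is reached from an odd index three below, so the value is the sum of 2 (3 +
  -- 4 k) over k < s.
  coefficient-2-even : ∀ s → q (s * 2 + 4) 2 ≡ s * (4 * s + 2)
  coefficient-2-even zero    = ≡.trans (coefficient-suc 3 1) (≡.cong₂ (λ x y → 1 * x + 2 * y)
    (≡.trans (δ-⊗ 1 (λ i → q i 2) 2) (≡.trans (coefficient-suc 1 1) (≡.cong₂ (λ x y → 1 * x + 2 * y)
      (≡.trans (δ-⊗ 1 (λ i → q i 2) 0) (proj₁ q-recursion 2)) (δ-⊗-< {2} {1} (λ i → q i 1) ℕ.≤-refl))))
    (≡.trans (δ-⊗ 2 (λ i → q i 1) 1) coefficient-1-at-1))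
  coefficient-2-even (suc s) = ≡.trans (coefficient-suc (suc (s * 2 + 4)) 1) (≡.trans
    (≡.cong₂ (λ x y → 1 * x + 2 * y)
      (≡.trans (δ-⊗ 1 (λ i → q i 2) (s * 2 + 4)) (coefficient-2-even s))
      (≡.trans (≡.cong (δ 2 ℕSeries.⊗ _) (≡.cong suc (ℕ.+-suc (s * 2) 3)))
        (≡.trans (δ-⊗ 2 (λ i → q i 1) (s * 2 + 3)) (coefficient-1-odd s))))
    (identity s))
    where
    identity : ∀ s → 1 * (s * (4 * s + 2)) + 2 * (3 + 4 * s) ≡ suc s * (4 * suc s + 2)
    identity = solve-∀

  -- Both a + 1 and b + 1 are odd, so each path needs an odd number of factors e₃ and starts at ε¹.
  -- Hence their product is compared at ε².
  even-bound : ∀ x y → Positive (suc y * 2) (suc x * 2) →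
    (3 + 4 * y) * (3 + 4 * x) ≤ suc (x + y) * (4 * suc (x + y) + 2)
  even-bound x y p = begin
    (3 + 4 * y) * (3 + 4 * x)
      ≡⟨ ≡.cong₂ _*_ (coefficient-1-odd y) (coefficient-1-odd x) ⟨
    q (y * 2 + 3) 1 * q (x * 2 + 3) 1
      ≡⟨ ≡.cong₂ (λ m n → q m 1 * q n 1) (ℕ.+-comm (y * 2) 3) (ℕ.+-comm (x * 2) 3) ⟩
    q (suc a) 1 * q (suc b) 1
      ≤⟨ ℕ.≤-trans (ℕ.m≤m+n _ _) (ℕ.≤-trans (ℕ.m≤n+m _ (q (suc a) 0 * q (suc b) 2)) (product-≤ p 2)) ⟩
    q (suc (suc (a + b))) 2
      ≡⟨ ≡.cong (λ n → q n 2) (total x y) ⟩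
    q (suc (x + y) * 2 + 4) 2
      ≡⟨ coefficient-2-even (suc (x + y)) ⟩
    suc (x + y) * (4 * suc (x + y) + 2) ∎
    where
    open ℕ.≤-Reasoning
    a = suc y * 2
    b = suc x * 2
    total : ∀ x y → suc (suc (suc y * 2 + suc x * 2)) ≡ suc (x + y) * 2 + 4
    total = solve-∀

-- The three clauses

module Mod3 {a b : ℕ} (p : Positive a b) (a≥2 : 2 ≤ a) (m : ℕ) (b≡ : b ≡ 2 + m * 3) where
  open ℕ.≤-Reasoning

  a%3≢2 : a % 3 ≢ 2
  a%3≢2 eq = not-both-multiples p 2 m (s≤s z≤n) (≡.cong suc b≡) (a / 3)
    (≡.cong suc (≡.trans (m≡m%n+[m/n]*n a 3) (≡.cong (_+ a / 3 * 3) eq)))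

  a%3≡0 : a % 3 ≡ 0 → a ≤ 2 * b + 2
  a%3≡0 eq = go (a / 3) (≡.trans (m≡m%n+[m/n]*n a 3) (≡.cong (_+ a / 3 * 3) eq))
    where
    go : ∀ k → a ≡ k * 3 → a ≤ 2 * b + 2
    go zero    a≡ = contradiction (≡.subst (2 ≤_) a≡ a≥2) λ ()
    -- Here a + 1 has residue 1, which e₄ represents: a + 1 = 3 k + 4, with one taken off the
    -- quotient.
    go (suc k) a≡ = begin
      a                       ≡⟨ a≡ ⟩
      suc k * 3               ≤⟨ ℕ.*-monoˡ-≤ 3 k< ⟩
      (2 * m + 2) * 3         ≡⟨ expand m ⟩
      2 * (2 + m * 3) + 2     ≡⟨ ≡.cong (λ x → 2 * x + 2) b≡ ⟨
      2 * b + 2               ∎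
      where
      expand : ∀ m → (2 * m + 2) * 3 ≡ 2 * (2 + m * 3) + 2
      expand = solve-∀
      lhs : ∀ k → 4 * 2 + 3 * k * 3 ≡ 7 + suc (9 * k)
      lhs = solve-∀
      rhs : ∀ m → 3 * 2 * suc m * 3 ≡ 9 * (2 * m + 2)
      rhs = solve-∀
      suc-a : ∀ k → suc (suc k * 3) ≡ k * 3 + 4
      suc-a = solve-∀
      k< : k < 2 * m + 2
      k< = ℕ.*-cancelˡ-< 9 k (2 * m + 2) (begin
        suc (9 * k)              ≤⟨ ℕ.m≤n+m _ 7 ⟩
        7 + suc (9 * k)          ≡⟨ lhs k ⟨
        4 * 2 + 3 * k * 3        ≤⟨ remainder-bound p 2 m (s≤s z≤n) (≡.cong suc b≡) k 3 (s≤s z≤n) (λ ()) ℕ.≤-refl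
                                      (≡.trans (≡.cong suc a≡) (suc-a k)) ⟩
        3 * 2 * suc m * 3        ≡⟨ rhs m ⟩
        9 * (2 * m + 2)          ∎)

  a%3≡1 : a % 3 ≡ 1 → a ≤ 2 * b ∸ 3
  a%3≡1 eq = begin
    a                          ≡⟨ a≡ ⟩
    1 + k * 3                  ≤⟨ ℕ.+-monoʳ-≤ 1 (ℕ.*-monoˡ-≤ 3 (ℕ.m<1+n⇒m≤n k<)) ⟩
    1 + 2 * m * 3              ≡⟨ ≡.cong (_∸ 3) (expand m) ⟩
    2 * (2 + m * 3) ∸ 3        ≡⟨ ≡.cong (λ x → 2 * x ∸ 3) b≡ ⟨
    2 * b ∸ 3                  ∎
    where
    k = a / 3
    a≡ : a ≡ 1 + k * 3
    a≡ = ≡.trans (m≡m%n+[m/n]*n a 3) (≡.cong (_+ k * 3) eq)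
    expand : ∀ m → 3 + (1 + 2 * m * 3) ≡ 2 * (2 + m * 3)
    expand = solve-∀
    lhs : ∀ k → 3 + suc (3 * k) ≡ 2 * 2 + 3 * k * 1
    lhs = solve-∀
    rhs : ∀ m → 3 * 2 * suc m * 1 ≡ 3 + 3 * suc (2 * m)
    rhs = solve-∀
    suc-a : ∀ k → suc (1 + k * 3) ≡ k * 3 + 2
    suc-a = solve-∀
    k< : k < suc (2 * m)
    k< = ℕ.*-cancelˡ-< 3 k (suc (2 * m)) (ℕ.+-cancelˡ-≤ 3 _ _ (begin
      3 + suc (3 * k)         ≡⟨ lhs k ⟩
      2 * 2 + 3 * k * 1       ≤⟨ remainder-bound p 2 m (s≤s z≤n) (≡.cong suc b≡) k 1 (s≤s z≤n) (λ ()) (s≤s z≤n)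
                                   (≡.trans (≡.cong suc a≡) (suc-a k)) ⟩
      3 * 2 * suc m * 1       ≡⟨ rhs m ⟩
      3 + 3 * suc (2 * m)     ∎))

  clause : ((a % 3 ≡ 0 × a ≤ 2 * b + 2) ⊎ (a % 3 ≡ 1 × a ≤ 2 * b ∸ 3)) × a % 3 ≢ 2
  clause = cases (a % 3) ≡.refl (m%n<n a 3) , a%3≢2
    where
    cases : ∀ r → a % 3 ≡ r → r < 3 → (a % 3 ≡ 0 × a ≤ 2 * b + 2) ⊎ (a % 3 ≡ 1 × a ≤ 2 * b ∸ 3)
    cases 0 eq _ = inj₁ (eq , a%3≡0 eq)
    cases 1 eq _ = inj₂ (eq , a%3≡1 eq)
    cases 2 eq _ = contradiction eq a%3≢2
    cases (suc (suc (suc _))) eq (s≤s (s≤s (s≤s ())))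

module Quadratic {a c : ℕ} (p : Positive a (2 + c)) (a≥b : 2 + c ≤ a) where
  open ℕ.≤-Reasoning

  b = 2 + c

  bound : ∀ k r → 0 < r → r ≢ b → r ≤ suc b → suc a ≡ k * suc b + suc r →
    suc r * b + suc b * k * r ≤ suc b * b * r
  bound k r 0<r r≢b r≤ a≡ = ≡.subst (λ x → suc r * b + suc b * k * r ≤ x * r) (ℕ.*-identityʳ (suc b * b))
    (remainder-bound p b 0 (s≤s z≤n) (≡.sym (ℕ.*-identityˡ (suc b))) k r 0<r r≢b r≤ a≡)

  quotient-< : ∀ k r → 0 < r → suc r * b + suc b * k * r ≤ suc b * b * r → k < b
  quotient-< k (suc r) 0<r le = ℕ.*-cancelˡ-< (suc b * suc r) k b (begin-strict
    suc b * suc r * k                             ≡⟨ swap (suc b) (suc r) k ⟩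
    suc b * k * suc r                             <⟨ ℕ.m<n+m _ (s≤s z≤n) ⟩
    suc (suc r) * b + suc b * k * suc r           ≤⟨ le ⟩
    suc b * b * suc r                             ≡⟨ swap (suc b) b (suc r) ⟩
    suc b * suc r * b                             ∎)
    where
    swap : ∀ x y z → x * y * z ≡ x * z * y
    swap = solve-∀

  -- The worst case is k = b - 2 and r = b + 1, where (b - 2)(b + 1) + (b + 2) = b².
  small : ∀ k r → k ≤ c → suc r ≤ 2 + b → suc a ≡ k * suc b + suc r → a ≤ b ^ 2 ∸ 1
  small k r k≤c r≤ a≡ = ℕ.∸-monoˡ-≤ 1 (begin
    suc a                        ≡⟨ a≡ ⟩
    k * suc b + suc r            ≤⟨ ℕ.+-mono-≤ (ℕ.*-monoˡ-≤ (suc b) k≤c) r≤ ⟩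
    c * (3 + c) + (4 + c)        ≡⟨ square c ⟩
    b ^ 2                        ∎)
    where
    square : ∀ c → c * (3 + c) + (4 + c) ≡ (2 + c) * ((2 + c) * 1)
    square = solve-∀

  -- The general bound leaves k ≤ b - 1, and k = b - 1 would force b ≤ r.
  middle : ∀ k r → 0 < r → r < b → suc a ≡ k * suc b + suc r → a ≤ b ^ 2 ∸ 1
  middle k r 0<r r<b a≡ = small k r (ℕ.m<1+n⇒m≤n (ℕ.≤∧≢⇒< (ℕ.m<1+n⇒m≤n (quotient-< k r 0<r le)) k≢))
    (ℕ.m≤n⇒m≤1+n (ℕ.m≤n⇒m≤1+n r<b)) a≡
    where
    le = bound k r 0<r (ℕ.<⇒≢ r<b) (ℕ.m≤n⇒m≤1+n (ℕ.<⇒≤ r<b)) a≡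
    lhs : ∀ c r → suc r * (2 + c) + suc (2 + c) * suc c * r ≡ 2 + c + ((3 + c) * suc c * r + (2 + c) * r)
    lhs = solve-∀
    rhs : ∀ c r → suc (2 + c) * (2 + c) * r ≡ r + ((3 + c) * suc c * r + (2 + c) * r)
    rhs = solve-∀
    k≢ : k ≢ suc c
    k≢ ≡.refl = ℕ.<⇒≱ r<b (ℕ.+-cancelʳ-≤ ((3 + c) * suc c * r + (2 + c) * r) b r (begin
      b + ((3 + c) * suc c * r + (2 + c) * r)    ≡⟨ lhs c r ⟨
      suc r * b + suc b * suc c * r              ≤⟨ le ⟩
      suc b * b * r                              ≡⟨ rhs c r ⟩
      r + ((3 + c) * suc c * r + (2 + c) * r)    ∎))

  -- For residue 1 the representative is r = b + 1, which is larger than b, so k = b - 1 survives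
  -- the bound. It yields the isolated value b² + b.
  large : ∀ k → suc a ≡ k * suc b + suc (suc b) → a ≤ b ^ 2 ∸ 1 ⊎ a ≡ b ^ 2 + b
  large k a≡ with k ℕ.≟ suc c
  ... | yes ≡.refl = inj₂ (ℕ.suc-injective (≡.trans a≡ (square c)))
    where
    square : ∀ c → suc c * suc (2 + c) + suc (suc (2 + c)) ≡ suc ((2 + c) * ((2 + c) * 1) + (2 + c))
    square = solve-∀
  ... | no k≢ = inj₁ (small k (suc b) (ℕ.m<1+n⇒m≤n (ℕ.≤∧≢⇒< (ℕ.m<1+n⇒m≤n
    (quotient-< k (suc b) (s≤s z≤n) (bound k (suc b) (s≤s z≤n) (λ eq → ℕ.1+n≢n eq) ℕ.≤-refl a≡))) k≢)) ℕ.≤-refl a≡)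

  clause : a ≤ b ^ 2 ∸ 1 ⊎ a ≡ b ^ 2 + b
  clause = cases (suc a % suc b) (suc a / suc b) (m%n<n (suc a) (suc b)) (m≡m%n+[m/n]*n (suc a) (suc b))
    where
    cases : ∀ r k → r < suc b → suc a ≡ r + k * suc b → a ≤ b ^ 2 ∸ 1 ⊎ a ≡ b ^ 2 + b
    cases 0 (suc k) _ a≡ = contradiction a≡
      (not-both-multiples p b 0 (s≤s z≤n) (≡.sym (ℕ.*-identityˡ (suc b))) k)
    cases 1 zero _ a≡ = contradiction (≡.subst (b ≤_) (ℕ.suc-injective a≡) a≥b) λ ()
    cases 1 (suc k) _ a≡ = large k (≡.trans a≡ (regroup b k))
      where
      regroup : ∀ b k → 1 + suc k * suc b ≡ k * suc b + suc (suc b)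
      regroup = solve-∀
    cases (suc (suc r)) k r< a≡ = inj₁ (middle k (suc r) (s≤s z≤n) (ℕ.s≤s⁻¹ r<)
      (≡.trans a≡ (ℕ.+-comm (suc (suc r)) (k * suc b))))

module BothEven (x E : ℕ)
  (le : (3 + 4 * (x + suc E)) * (3 + 4 * x) ≤ suc (x + (x + suc E)) * (4 * suc (x + (x + suc E)) + 2)) where
  open ℕ.≤-Reasoning

  -- Half of a - b, where b = 2 (x + 1); the case a = b is refuted separately in `even-clause`.
  D = suc E
  common = 16 * x * x + 16 * x * D + 20 * x + 10 * D + 6

  quarter : 2 * suc (2 * x + D) < 2 * (2 * (D * D))
  quarter = ℕ.+-cancelˡ-≤ common _ _ (begin
    common + suc (2 * suc (2 * x + D))    ≡⟨ lhs x D ⟩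
    (3 + 4 * (x + D)) * (3 + 4 * x)       ≤⟨ le ⟩
    suc (x + (x + D)) * (4 * suc (x + (x + D)) + 2) ≡⟨ rhs x D ⟩
    common + 2 * (2 * (D * D))            ∎)
    where
    lhs : ∀ x D → 16 * x * x + 16 * x * D + 20 * x + 10 * D + 6 + suc (2 * suc (2 * x + D))
      ≡ (3 + 4 * (x + D)) * (3 + 4 * x)
    lhs = solve-∀
    rhs : ∀ x D → suc (x + (x + D)) * (4 * suc (x + (x + D)) + 2)
      ≡ 16 * x * x + 16 * x * D + 20 * x + 10 * D + 6 + 2 * (2 * (D * D))
    rhs = solve-∀

  -- Halving gains one by parity, and this makes the final inequality strict.
  half : 2 + (2 * x + D) ≤ 2 * (D * D)
  half = ℕ.*-cancelˡ-< 2 _ _ quarter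

  -- Since 2 a - (2 b + 1) = 4 D - 1 = 3 + 4 E, the goal is (4 D - 1)² > 8 b - 3 = 16 x + 13. Eight
  -- times `half` gives (4 D - 1)² ≥ 16 x + 17; the summand 7 + 8 E = 8 D - 1 completes the square
  -- to 16 D².
  square-< : 8 * (suc x * 2) ∸ 3 < (3 + 4 * E) * (3 + 4 * E)
  square-< = ℕ.+-cancelʳ-≤ (7 + 8 * E) _ _ (begin
    suc (8 * (suc x * 2) ∸ 3) + (7 + 8 * E)    ≡⟨ ≡.cong (λ y → suc (y ∸ 3) + (7 + 8 * E)) (expand x) ⟩
    suc (13 + 16 * x) + (7 + 8 * E)            ≤⟨ ℕ.m≤n+m _ 3 ⟩
    3 + (suc (13 + 16 * x) + (7 + 8 * E))      ≡⟨ lhs x E ⟩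
    8 * (2 + (2 * x + D))                      ≤⟨ ℕ.*-monoʳ-≤ 8 half ⟩
    8 * (2 * (D * D))                          ≡⟨ rhs E ⟩
    (3 + 4 * E) * (3 + 4 * E) + (7 + 8 * E)    ∎)
    where
    expand : ∀ x → 8 * (suc x * 2) ≡ 3 + (13 + 16 * x)
    expand = solve-∀
    lhs : ∀ x E → 3 + (suc (13 + 16 * x) + (7 + 8 * E)) ≡ 8 * (2 + (2 * x + suc E))
    lhs = solve-∀
    rhs : ∀ E → 8 * (2 * (suc E * suc E)) ≡ (3 + 4 * E) * (3 + 4 * E) + (7 + 8 * E)
    rhs = solve-∀

  difference : (2 * (suc (x + suc E) * 2)) ⊖ (2 * (suc x * 2) + 1) ≡ + (3 + 4 * E)
  difference = ≡.trans (≡.cong (_⊖ (2 * (suc x * 2) + 1)) (expand x E))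
    (≡.trans (ℤ.⊖-≥ (ℕ.m≤m+n (2 * (suc x * 2) + 1) (3 + 4 * E)))
      (≡.cong +_ (ℕ.m+n∸m≡n (2 * (suc x * 2) + 1) (3 + 4 * E))))
    where
    expand : ∀ x E → 2 * (suc (x + suc E) * 2) ≡ 2 * (suc x * 2) + 1 + (3 + 4 * E)
    expand = solve-∀

  clause : ((2 * (suc (x + suc E) * 2)) ⊖ (2 * (suc x * 2) + 1)) >√ (8 * (suc x * 2) ∸ 3)
  clause = ≡.subst (_>√ (8 * (suc x * 2) ∸ 3)) (≡.sym difference)
    (ℤ.+≤+ z≤n , ≡.subst (+ (8 * (suc x * 2) ∸ 3) ℤ.<_) (ℤ.pos-* (3 + 4 * E) (3 + 4 * E)) (ℤ.+<+ square-<))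

even-clause : ∀ x y → suc x * 2 ≤ suc y * 2 → Positive (suc y * 2) (suc x * 2) →
  ((2 * (suc y * 2)) ⊖ (2 * (suc x * 2) + 1)) >√ (8 * (suc x * 2) ∸ 3)
even-clause x y b≤a p with ℕ.m≤n⇒∃[o]m+o≡n (ℕ.s≤s⁻¹ (ℕ.*-cancelʳ-≤ (suc x) (suc y) 2 b≤a))
-- For a = b the inequality at ε² fails by exactly 3 + 4 x.
... | zero  , ≡.refl = contradiction (Even.even-bound x (x + 0) p) (ℕ.<⇒≱ (begin-strict
    suc (x + (x + 0)) * (4 * suc (x + (x + 0)) + 2)              <⟨ ℕ.m<n+m _ {3 + 4 * x} (s≤s z≤n) ⟩
    (3 + 4 * x) + suc (x + (x + 0)) * (4 * suc (x + (x + 0)) + 2) ≡⟨ identity x ⟩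
    (3 + 4 * (x + 0)) * (3 + 4 * x)                               ∎))
  where
  open ℕ.≤-Reasoning
  identity : ∀ x → (3 + 4 * x) + suc (x + (x + 0)) * (4 * suc (x + (x + 0)) + 2) ≡ (3 + 4 * (x + 0)) * (3 + 4 * x)
  identity = solve-∀
... | suc E , ≡.refl = BothEven.clause x E (Even.even-bound x (x + suc E) p)

theorem3p3 : (a b : ℕ) → 2 ∣ b → a ≥ b → b ≥ 2 →
    EPositiveGraph (spider (a ∷ b ∷ 1 ∷ [])) →
    (b % 3 ≡ 2 →
    ((a % 3 ≡ 0 × a ≤ 2 * b + 2) ⊎ (a % 3 ≡ 1 × a ≤ 2 * b ∸ 3)) × a % 3 ≢ 2)
    × (b % 3 ≢ 2 → a ≤ b ^ 2 ∸ 1 ⊎ a ≡ b ^ 2 + b)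
    × (2 ∣ a → ((2 * a) ⊖ (2 * b + 1)) >√ (8 * b ∸ 3))
theorem3p3 a b 2∣b a≥b b≥2 pos =
    (λ b%3 → Mod3.clause p (ℕ.≤-trans b≥2 a≥b) (b / 3) (≡.trans (m≡m%n+[m/n]*n b 3) (≡.cong (_+ b / 3 * 3) b%3)))
  , (λ _ → quadratic a≥b b≥2 p)
  , (λ 2∣a → even 2∣a 2∣b a≥b b≥2 p)
  where
  p : Positive a b
  p = positive pos

  quadratic : ∀ {b} → a ≥ b → b ≥ 2 → Positive a b → a ≤ b ^ 2 ∸ 1 ⊎ a ≡ b ^ 2 + b
  quadratic a≥b (s≤s (s≤s _)) p = Quadratic.clause p a≥b

  even : ∀ {a b} → 2 ∣ a → 2 ∣ b → a ≥ b → b ≥ 2 → Positive a b → ((2 * a) ⊖ (2 * b + 1)) >√ (8 * b ∸ 3)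
  even (divides (suc y) ≡.refl) (divides (suc x) ≡.refl) a≥b b≥2 p = even-clause x y a≥b p
  even (divides zero    ≡.refl) (divides x       ≡.refl) a≥b b≥2 p = contradiction (ℕ.≤-trans b≥2 a≥b) λ ()
  even (divides (suc y) ≡.refl) (divides zero    ≡.refl) a≥b ()  p
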